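{- In IITT, if $\Gamma\vdash(x\star U)\to^{s_1,s_2}T=(x\star U')\to^{s_1',s_2'}T':s_3$, then $s_1=s_1'$, $s_2=s_2'$, $\Gamma\vdash U=U':s_1$, and $\Gamma.x\star U\vdash T=T':s_2$.
   Context: Irrelevant Intensional Type Theory (IITT) is defined as follows. Sorts are $\mathsf{Set}_k$ ($k\in\mathbb{N}$), with $\mathsf{Axiom}=\{(\mathsf{Set}_i,\mathsf{Set}_{i+1})\mid i\in\mathbb{N}\}$ and $\mathsf{Rule}=\{(\mathsf{Set}_i,\mathsf{Set}_j,\mathsf{Set}_{\max(i,j)})\mid i,j\in\mathbb{N}\}$. Annotations are $\star\in\{:,\div\}$ (relevant, irrelevant). Expressions: $t,u,T,U ::= s \mid (x\star U)\to^{s,s'}T \mid x \mid \lambda x\star U.\,t \mid t\star u$, where $(x\star U)\to^{s,s'}T$ is a relevant or irrelevant dependent function type annotated with the sort $s$ of its domain and $s'$ of its codomain, and $t\star u$ is relevant application (also written $t\,u$) or irrelevant application $t\div u$. Expressions are taken modulo $\alpha$-equivalence; $[u/x]t$ is capture-avoiding substitution. Contexts: $\Gamma ::= () \mid \Gamma.\,x\star T$ (variables distinct). Resurrection $\Gamma^{\oplus}$ replaces each binding $x\div T$ by $x:T$. Abbreviations: $\Gamma\vdash t\div T$ means $\Gamma^\oplus\vdash t:T$; $\Gamma\vdash t=t'\div T$ means $\Gamma\vdash t\div T$ and $\Gamma\vdash t'\div T$; $\Gamma\vdash T$ means $\Gamma\vdash T:s$ for some sort $s$; $\Gamma\vdash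 T=T'$ means $\Gamma\vdash T=T':s$ for some $s$. The judgements $\vdash\Gamma$, $\Gamma\vdash t:T$, $\Gamma\vdash t=t':T$ are defined mutually inductively by: (contexts) $\vdash()$; from $\vdash\Gamma$ and $\Gamma\vdash T$ infer $\vdash\Gamma.x\star T$. (typing) from $\vdash\Gamma$, $(s,s')\in\mathsf{Axiom}$ infer $\Gamma\vdash s:s'$; from $\Gamma\vdash U:s_1$, $\Gamma.x\star U\vdash T:s_2$, $(s_1,s_2,s_3)\in\mathsf{Rule}$ infer $\Gamma\vdash (x\star U)\to^{s_1,s_2}T:s_3$; from $\vdash\Gamma$ and $(x:U)\in\Gamma$ infer $\Gamma\vdash x:U$ (no variable rule for irrelevant bindings); from $\Gamma.x\star U\vdash t:T$ and $\Gamma\vdash (x\star U)\to^{s,s'}T$ infer $\Gamma\vdash \lambda x\star U.t:(x\star U)\to^{s,s'}T$; from $\Gamma\vdash t:(x\star U)\to^{s,s'}T$ and $\Gamma\vdash u\star U$ infer $\Gamma\vdash t\star u:[u/x]T$; from $\Gamma\vdash t:T$ and $\Gamma\vdash T=T'$ infer $\Gamma\vdash t:T'$. (equality) $\beta$: from $\Gamma.x\star U\vdash t:T$ and $\Gamma\vdash u\star U$ infer $\Gamma\vdash(\lambda x\star U.t)\star u=[u/x]t:[u/x]T$; $\eta$: from $\Gamma\vdash t:(x\star U)\to^{s,s'}T$ infer $\Gamma\vdash t=\lambda x\star U.(t\star x):(x\star U)\to^{s,s'}T$; reflexivity, symmetry, transitivity; from $\Gamma\vdash U=U':s_1$, $\Gamma.x\star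 U\vdash T=T':s_2$, $(s_1,s_2,s_3)\in\mathsf{Rule}$ infer $\Gamma\vdash (x\star U)\to^{s_1,s_2}T=(x\star U')\to^{s_1,s_2}T':s_3$; from $\Gamma\vdash U=U':s_1$, $\Gamma.x\star U\vdash T:s_2$, $\Gamma.x\star U\vdash t=t':T$ infer $\Gamma\vdash\lambda x\star U.t=\lambda x\star U'.t':(x\star U)\to^{s_1,s_2}T$; from $\Gamma\vdash t=t':(x\star U)\to^{s,s'}T$ and $\Gamma\vdash u=u'\star U$ infer $\Gamma\vdash t\star u=t'\star u':[u/x]T$; from $\Gamma\vdash t=t':T$ and $\Gamma\vdash T=T'$ infer $\Gamma\vdash t=t':T'$. -}

module Defs where

open import Data.Nat using (ℕ; zero; suc; _⊔_)
open import Data.Product using (_×_; _,_)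

data Sort : Set where
  𝕊 : ℕ → Sort

data Axiom : Sort → Sort → Set where
  ax : ∀ i → Axiom (𝕊 i) (𝕊 (suc i))

data Rule : Sort → Sort → Sort → Set where
  rule : ∀ i j → Rule (𝕊 i) (𝕊 j) (𝕊 (i ⊔ j))

data Ann : Set where
  rel irr : Ann

-- Expressions, with de Bruijn indices (α-equivalence is syntactic identity)
data Tm : Set where
  sort : Sort → Tm
  Pi   : Ann → Sort → Sort → Tm → Tm → Tm   -- Pi ⋆ s s' U T  =  (x ⋆ U) →^{s,s'} T, T binds x
  var  : ℕ → Tm
  lam  : Ann → Tm → Tm → Tm                 -- lam ⋆ U t  =  λ x ⋆ U. t, t binds x
  app  : Ann → Tm → Tm → Tm

ext : (ℕ → ℕ) → ℕ → ℕ
ext ρ zero    = zero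
ext ρ (suc n) = suc (ρ n)

rename : (ℕ → ℕ) → Tm → Tm
rename ρ (sort s)       = sort s
rename ρ (Pi a s s' U T) = Pi a s s' (rename ρ U) (rename (ext ρ) T)
rename ρ (var n)        = var (ρ n)
rename ρ (lam a U t)    = lam a (rename ρ U) (rename (ext ρ) t)
rename ρ (app a t u)    = app a (rename ρ t) (rename ρ u)

weaken : Tm → Tm
weaken = rename suc

exts : (ℕ → Tm) → ℕ → Tm
exts σ zero    = var zero
exts σ (suc n) = weaken (σ n)

subst : (ℕ → Tm) → Tm → Tm
subst σ (sort s)        = sort s
subst σ (Pi a s s' U T) = Pi a s s' (subst σ U) (subst (exts σ) T)
subst σ (var n)         = σ n
subst σ (lam a U t)     = lam a (subst σ U) (subst (exts σ) t)
subst σ (app a t u)     = app a (subst σ t) (subst σ u)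

single : Tm → ℕ → Tm
single u zero    = u
single u (suc n) = var n

_[_] : Tm → Tm → Tm
t [ u ] = subst (single u) t

infixl 5 _▷_
data Ctx : Set where
  ε   : Ctx
  _▷_ : Ctx → Ann × Tm → Ctx

_⊕ : Ctx → Ctx
ε ⊕ = ε
(Γ ▷ (a , T)) ⊕ = (Γ ⊕) ▷ (rel , T)

data _∋_∶_ : Ctx → ℕ → Tm → Set where
  here  : ∀ {Γ U} → (Γ ▷ (rel , U)) ∋ zero ∶ weaken U
  there : ∀ {Γ b n U} → Γ ∋ n ∶ U → (Γ ▷ b) ∋ suc n ∶ weaken U

infix 4 ⊢_ _⊢_∶_ _⊢_≣_∶_ _⊢_∶[_]_ _⊢_≣_∶[_]_

mutual
  data ⊢_ : Ctx → Set where
    wf-ε : ⊢ ε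
    wf-▷ : ∀ {Γ a T s} → ⊢ Γ → Γ ⊢ T ∶ sort s → ⊢ (Γ ▷ (a , T))

  data _⊢_∶[_]_ : Ctx → Tm → Ann → Tm → Set where
    ty-rel : ∀ {Γ u U} → Γ ⊢ u ∶ U → Γ ⊢ u ∶[ rel ] U
    ty-irr : ∀ {Γ u U} → (Γ ⊕) ⊢ u ∶ U → Γ ⊢ u ∶[ irr ] U

  data _⊢_≣_∶[_]_ : Ctx → Tm → Tm → Ann → Tm → Set where
    eq-rel : ∀ {Γ u u' U} → Γ ⊢ u ≣ u' ∶ U → Γ ⊢ u ≣ u' ∶[ rel ] U
    eq-irr : ∀ {Γ u u' U} → (Γ ⊕) ⊢ u ∶ U → (Γ ⊕) ⊢ u' ∶ U → Γ ⊢ u ≣ u' ∶[ irr ] U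

  data _⊢_∶_ : Ctx → Tm → Tm → Set where
    ty-sort : ∀ {Γ s s'} → ⊢ Γ → Axiom s s' → Γ ⊢ sort s ∶ sort s'
    ty-pi   : ∀ {Γ a U T s₁ s₂ s₃} →
              Γ ⊢ U ∶ sort s₁ → (Γ ▷ (a , U)) ⊢ T ∶ sort s₂ → Rule s₁ s₂ s₃ →
              Γ ⊢ Pi a s₁ s₂ U T ∶ sort s₃
    ty-var  : ∀ {Γ x U} → ⊢ Γ → Γ ∋ x ∶ U → Γ ⊢ var x ∶ U
    ty-lam  : ∀ {Γ a U t T s s' s''} →
              (Γ ▷ (a , U)) ⊢ t ∶ T → Γ ⊢ Pi a s s' U T ∶ sort s'' →
              Γ ⊢ lam a U t ∶ Pi a s s' U T
    ty-app  : ∀ {Γ a t u U T s s'} →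
              Γ ⊢ t ∶ Pi a s s' U T → Γ ⊢ u ∶[ a ] U →
              Γ ⊢ app a t u ∶ T [ u ]
    ty-conv : ∀ {Γ t T T' s} → Γ ⊢ t ∶ T → Γ ⊢ T ≣ T' ∶ sort s → Γ ⊢ t ∶ T'

  data _⊢_≣_∶_ : Ctx → Tm → Tm → Tm → Set where
    eq-β     : ∀ {Γ a U t T u} →
               (Γ ▷ (a , U)) ⊢ t ∶ T → Γ ⊢ u ∶[ a ] U →
               Γ ⊢ app a (lam a U t) u ≣ t [ u ] ∶ T [ u ]
    eq-η     : ∀ {Γ a U T t s s'} →
               Γ ⊢ t ∶ Pi a s s' U T →
               Γ ⊢ t ≣ lam a U (app a (weaken t) (var zero)) ∶ Pi a s s' U T
    eq-refl  : ∀ {Γ t T} → Γ ⊢ t ∶ T → Γ ⊢ t ≣ t ∶ T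
    eq-sym   : ∀ {Γ t t' T} → Γ ⊢ t ≣ t' ∶ T → Γ ⊢ t' ≣ t ∶ T
    eq-trans : ∀ {Γ t t' t'' T} → Γ ⊢ t ≣ t' ∶ T → Γ ⊢ t' ≣ t'' ∶ T → Γ ⊢ t ≣ t'' ∶ T
    eq-pi    : ∀ {Γ a U U' T T' s₁ s₂ s₃} →
               Γ ⊢ U ≣ U' ∶ sort s₁ → (Γ ▷ (a , U)) ⊢ T ≣ T' ∶ sort s₂ → Rule s₁ s₂ s₃ →
               Γ ⊢ Pi a s₁ s₂ U T ≣ Pi a s₁ s₂ U' T' ∶ sort s₃
    eq-lam   : ∀ {Γ a U U' T t t' s₁ s₂} →
               Γ ⊢ U ≣ U' ∶ sort s₁ → (Γ ▷ (a , U)) ⊢ T ∶ sort s₂ →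
               (Γ ▷ (a , U)) ⊢ t ≣ t' ∶ T →
               Γ ⊢ lam a U t ≣ lam a U' t' ∶ Pi a s₁ s₂ U T
    eq-app   : ∀ {Γ a t t' u u' U T s s'} →
               Γ ⊢ t ≣ t' ∶ Pi a s s' U T → Γ ⊢ u ≣ u' ∶[ a ] U →
               Γ ⊢ app a t u ≣ app a t' u' ∶ T [ u ]
    eq-conv  : ∀ {Γ t t' T T' s} → Γ ⊢ t ≣ t' ∶ T → Γ ⊢ T ≣ T' ∶ sort s → Γ ⊢ t ≣ t' ∶ T'

{-# OPTIONS --safe #-}
module Submission where

-- The theorem is read off a Kripke logical relation at the identity substitution. The relation is
-- built for an equivalent system whose rules have extra premises. These premises are derivable in
-- the original system, but only by validity, injectivity and functionality of substitution, and
-- the logical relation is what provides these.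
-- There are no base types, so only types are weak head normalised: elements of a neutral type are
-- related as soon as they are equal, and elements of a function type are compared through application.
-- Irrelevant arguments need not be reducible: being well typed in the resurrected context is enough,
-- because they never reach the head of a relevant computation.

-- Irrelevance shapes the relation. Two related irrelevant arguments `x` and `y` are merely well
-- typed, with no equation between them, yet application must send them to related results over
-- `G [ x ]` and `G' [ y ]`. So elements are compared over a pair of related types and typed at its
-- left end, and the recurring problem is to move an element from one pair to another. One common
-- endpoint is enough for this; where two pairs have none, a third pair with an endpoint from each
-- is interposed, usually by replacing the arguments `(x , y)` with `(y , y)`.
--
-- The extra premises are a matter of well-founded recursion. The fundamental theorem is an
-- induction on derivations and may be applied only to subderivations, whereas a typing obtained
-- from validity or functionality would be a new derivation. Once the theorem is proved, the
-- translation into the enriched system may use its consequences freely.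

open import Defs
open import Data.Empty using (⊥-elim)
open import Data.Nat using (ℕ; zero; suc; _⊔_; _≤_; _<′_; ≤′-reflexive; ≤′-step)
open import Data.Nat.Properties using (≤⇒≤′; ≤′⇒≤; m≤m⊔n; m≤n⊔m; ≤-trans)
open import Data.Product using (_×_; _,_; proj₂; Σ; ∃-syntax)
open import Data.Unit using (⊤; tt)
open import Function using (_∘_)
open import Relation.Binary.Construct.Closure.ReflexiveTransitive using (Star; _◅_; _◅◅_; gmap) renaming (ε to done)
open import Relation.Binary.PropositionalEquality
  using (_≡_; refl; sym; trans; cong; cong₂; _≗_) renaming (subst to transport)
open import Relation.Nullary using (¬_)

-- Substitution calculus

cong-Pi : ∀ {a s s' U U' T T'} → U ≡ U' → T ≡ T' → Pi a s s' U T ≡ Pi a s s' U' T'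
cong-Pi refl refl = refl

infixr 6 _∷_
_∷_ : Tm → (ℕ → Tm) → ℕ → Tm
(u ∷ σ) zero    = u
(u ∷ σ) (suc n) = σ n

-- In the fusion laws the composite enters as a map `τ` known pointwise, so passing a binder only
-- means re-establishing the hypothesis at `zero` and at `suc n`.
rename-rename : ∀ {ρ' ρ τ} → ρ' ∘ ρ ≗ τ → rename ρ' ∘ rename ρ ≗ rename τ
rename-rename e (sort s)        = refl
rename-rename e (Pi a s s' U T) =
  cong-Pi (rename-rename e U) (rename-rename (λ { zero → refl ; (suc n) → cong suc (e n) }) T)
rename-rename e (var n)         = cong var (e n)
rename-rename e (lam a U t)     =
  cong₂ (lam a) (rename-rename e U) (rename-rename (λ { zero → refl ; (suc n) → cong suc (e n) }) t)
rename-rename e (app a t u)     = cong₂ (app a) (rename-rename e t) (rename-rename e u)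

subst-rename : ∀ {σ ρ τ} → σ ∘ ρ ≗ τ → subst σ ∘ rename ρ ≗ subst τ
subst-rename e (sort s)        = refl
subst-rename e (Pi a s s' U T) =
  cong-Pi (subst-rename e U) (subst-rename (λ { zero → refl ; (suc n) → cong weaken (e n) }) T)
subst-rename e (var n)         = e n
subst-rename e (lam a U t)     =
  cong₂ (lam a) (subst-rename e U) (subst-rename (λ { zero → refl ; (suc n) → cong weaken (e n) }) t)
subst-rename e (app a t u)     = cong₂ (app a) (subst-rename e t) (subst-rename e u)

rename-ext-weaken : ∀ {ρ} t → rename (ext ρ) (weaken t) ≡ weaken (rename ρ t)
rename-ext-weaken t = trans (rename-rename (λ _ → refl) t) (sym (rename-rename (λ _ → refl) t))

rename-subst : ∀ {ρ σ τ} → rename ρ ∘ σ ≗ τ → rename ρ ∘ subst σ ≗ subst τ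
rename-subst-exts : ∀ {ρ σ τ} → rename ρ ∘ σ ≗ τ → rename (ext ρ) ∘ subst (exts σ) ≗ subst (exts τ)

rename-subst e (sort s)        = refl
rename-subst e (Pi a s s' U T) = cong-Pi (rename-subst e U) (rename-subst-exts e T)
rename-subst e (var n)         = e n
rename-subst e (lam a U t)     = cong₂ (lam a) (rename-subst e U) (rename-subst-exts e t)
rename-subst e (app a t u)     = cong₂ (app a) (rename-subst e t) (rename-subst e u)

rename-subst-exts {σ = σ} e = rename-subst λ
  { zero → refl ; (suc n) → trans (rename-ext-weaken (σ n)) (cong weaken (e n)) }

subst-exts-weaken : ∀ {σ} t → subst (exts σ) (weaken t) ≡ weaken (subst σ t)
subst-exts-weaken t = trans (subst-rename (λ _ → refl) t) (sym (rename-subst (λ _ → refl) t))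

subst-subst : ∀ {σ' σ τ} → subst σ' ∘ σ ≗ τ → subst σ' ∘ subst σ ≗ subst τ
subst-subst-exts : ∀ {σ' σ τ} → subst σ' ∘ σ ≗ τ → subst (exts σ') ∘ subst (exts σ) ≗ subst (exts τ)

subst-subst e (sort s)        = refl
subst-subst e (Pi a s s' U T) = cong-Pi (subst-subst e U) (subst-subst-exts e T)
subst-subst e (var n)         = e n
subst-subst e (lam a U t)     = cong₂ (lam a) (subst-subst e U) (subst-subst-exts e t)
subst-subst e (app a t u)     = cong₂ (app a) (subst-subst e t) (subst-subst e u)

subst-subst-exts {σ = σ} e = subst-subst λ
  { zero → refl ; (suc n) → trans (subst-exts-weaken (σ n)) (cong weaken (e n)) }

subst-id : ∀ {σ} → σ ≗ var → ∀ t → subst σ t ≡ t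
subst-id e (sort s)        = refl
subst-id e (Pi a s s' U T) =
  cong-Pi (subst-id e U) (subst-id (λ { zero → refl ; (suc n) → cong weaken (e n) }) T)
subst-id e (var n)         = e n
subst-id e (lam a U t)     =
  cong₂ (lam a) (subst-id e U) (subst-id (λ { zero → refl ; (suc n) → cong weaken (e n) }) t)
subst-id e (app a t u)     = cong₂ (app a) (subst-id e t) (subst-id e u)

-- Instead of a new induction, `t` is replaced by its image under the identity substitution and
-- fusion does the rest; likewise for `subst-cong`.
rename≡subst : ∀ {ρ σ} → var ∘ ρ ≗ σ → rename ρ ≗ subst σ
rename≡subst {ρ} e t =
  trans (cong (rename ρ) (sym (subst-id (λ _ → refl) t))) (rename-subst e t)

subst-cong : ∀ {σ τ} → σ ≗ τ → subst σ ≗ subst τ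
subst-cong {σ} e t = trans (cong (subst σ) (sym (subst-id (λ _ → refl) t))) (subst-subst e t)

subst-[] : ∀ σ T u → subst σ (T [ u ]) ≡ subst (exts σ) T [ subst σ u ]
subst-[] σ T u = trans (subst-subst {τ = subst σ u ∷ σ} (λ { zero → refl ; (suc n) → refl }) T)
  (sym (subst-subst (λ { zero → refl
                       ; (suc n) → trans (subst-rename (λ _ → refl) (σ n)) (subst-id (λ _ → refl) (σ n)) }) T))

weaken-[] : ∀ t u → weaken t [ u ] ≡ t
weaken-[] t u = trans (subst-rename (λ _ → refl) t) (subst-id (λ _ → refl) t)

exts-[] : ∀ σ T u → subst (exts σ) T [ u ] ≡ subst (u ∷ σ) T
exts-[] σ T u = subst-subst (λ { zero → refl ; (suc n) → weaken-[] (σ n) u }) T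

rename-[] : ∀ ρ T u → rename ρ (T [ u ]) ≡ rename (ext ρ) T [ rename ρ u ]
rename-[] ρ T u = trans (rename-subst {τ = rename ρ u ∷ (var ∘ ρ)} (λ { zero → refl ; (suc n) → refl }) T)
  (sym (subst-rename (λ { zero → refl ; (suc n) → refl }) T))

rename-exts-[] : ∀ ρ σ T u → rename (ext ρ) (subst (exts σ) T) [ u ] ≡ subst (u ∷ (rename ρ ∘ σ)) T
rename-exts-[] ρ σ T u =
  trans (cong (_[ u ]) (rename-subst-exts {τ = rename ρ ∘ σ} (λ _ → refl) T)) (exts-[] (rename ρ ∘ σ) T u)

ext-weaken-[var] : ∀ T → rename (ext suc) T [ var zero ] ≡ T
ext-weaken-[var] T = trans (subst-rename (λ { zero → refl ; (suc n) → refl }) T) (subst-id (λ _ → refl) T)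

⊕-idem : ∀ Γ → (Γ ⊕) ⊕ ≡ Γ ⊕
⊕-idem ε             = refl
⊕-idem (Γ ▷ (a , T)) = cong (_▷ (rel , T)) (⊕-idem Γ)

∋-⊕ : ∀ {Γ x A} → Γ ∋ x ∶ A → (Γ ⊕) ∋ x ∶ A
∋-⊕ here      = here
∋-⊕ (there i) = there (∋-⊕ i)

-- The system with a single judgement

-- All typing is expressed by the diagonal of ≈, and each rule carries as premises the
-- typings that the substitution and validity properties of the original system would supply.
infix 4 _⊢_≈_∶_ _⊢_≈_∶⟨_⟩_

data Wf : Ctx → Set
data _⊢_≈_∶_ : Ctx → Tm → Tm → Tm → Set
data _⊢_≈_∶⟨_⟩_ : Ctx → Tm → Tm → Ann → Tm → Set

data Wf where
  wf-ε : Wf ε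
  wf-▷ : ∀ {Γ a T s} → Wf Γ → Γ ⊢ T ≈ T ∶ sort s → Wf (Γ ▷ (a , T))

data _⊢_≈_∶⟨_⟩_ where
  arg-rel : ∀ {Γ u u' U} → Γ ⊢ u ≈ u' ∶ U → Γ ⊢ u ≈ u' ∶⟨ rel ⟩ U
  arg-irr : ∀ {Γ u u' U} → Γ ⊕ ⊢ u ≈ u ∶ U → Γ ⊕ ⊢ u' ≈ u' ∶ U → Γ ⊢ u ≈ u' ∶⟨ irr ⟩ U

data _⊢_≈_∶_ where
  ≈-sort  : ∀ {Γ i} → Wf Γ → Γ ⊢ sort (𝕊 i) ≈ sort (𝕊 i) ∶ sort (𝕊 (suc i))
  ≈-var   : ∀ {Γ x U} → Wf Γ → Γ ∋ x ∶ U → Γ ⊢ var x ≈ var x ∶ U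
  ≈-pi    : ∀ {Γ a U U' T T' s₁ s₂ s₃} →
            Γ ⊢ U ≈ U' ∶ sort s₁ → Γ ▷ (a , U) ⊢ T ≈ T' ∶ sort s₂ →
            Γ ▷ (a , U') ⊢ T' ≈ T' ∶ sort s₂ → Rule s₁ s₂ s₃ →
            Γ ⊢ Pi a s₁ s₂ U T ≈ Pi a s₁ s₂ U' T' ∶ sort s₃
  ≈-lam   : ∀ {Γ a U U' T t t' s₁ s₂} →
            Γ ⊢ U ≈ U' ∶ sort s₁ → Γ ▷ (a , U) ⊢ T ≈ T ∶ sort s₂ → Γ ▷ (a , U) ⊢ t ≈ t' ∶ T →
            Γ ▷ (a , U') ⊢ T ≈ T ∶ sort s₂ → Γ ▷ (a , U') ⊢ t' ≈ t' ∶ T →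
            Γ ⊢ lam a U t ≈ lam a U' t' ∶ Pi a s₁ s₂ U T
  ≈-app   : ∀ {Γ a t t' u u' U T s₁ s₂} →
            Γ ⊢ t ≈ t' ∶ Pi a s₁ s₂ U T → Γ ⊢ u ≈ u' ∶⟨ a ⟩ U → Γ ⊢ T [ u ] ≈ T [ u' ] ∶ sort s₂ →
            Γ ⊢ app a t u ≈ app a t' u' ∶ T [ u ]
  ≈-β     : ∀ {Γ a U t T u s₁ s₂} →
            Γ ⊢ U ≈ U ∶ sort s₁ → Γ ▷ (a , U) ⊢ T ≈ T ∶ sort s₂ →
            Γ ▷ (a , U) ⊢ t ≈ t ∶ T → Γ ⊢ u ≈ u ∶⟨ a ⟩ U → Γ ⊢ t [ u ] ≈ t [ u ] ∶ T [ u ] →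
            Γ ⊢ app a (lam a U t) u ≈ t [ u ] ∶ T [ u ]
  ≈-η     : ∀ {Γ a U T t s₁ s₂} →
            Γ ⊢ t ≈ t ∶ Pi a s₁ s₂ U T →
            Γ ⊢ lam a U (app a (weaken t) (var zero)) ≈ lam a U (app a (weaken t) (var zero)) ∶ Pi a s₁ s₂ U T →
            Γ ⊢ t ≈ lam a U (app a (weaken t) (var zero)) ∶ Pi a s₁ s₂ U T
  ≈-sym   : ∀ {Γ t u T} → Γ ⊢ t ≈ u ∶ T → Γ ⊢ u ≈ t ∶ T
  ≈-trans : ∀ {Γ t u v T} → Γ ⊢ t ≈ u ∶ T → Γ ⊢ u ≈ v ∶ T → Γ ⊢ t ≈ v ∶ T
  ≈-conv  : ∀ {Γ t u T T' s} → Γ ⊢ t ≈ u ∶ T → Γ ⊢ T ≈ T' ∶ sort s → Γ ⊢ t ≈ u ∶ T'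

≈-reflˡ : ∀ {Γ t u T} → Γ ⊢ t ≈ u ∶ T → Γ ⊢ t ≈ t ∶ T
≈-reflˡ e = ≈-trans e (≈-sym e)

≈-reflʳ : ∀ {Γ t u T} → Γ ⊢ t ≈ u ∶ T → Γ ⊢ u ≈ u ∶ T
≈-reflʳ e = ≈-trans (≈-sym e) e

arg-reflˡ : ∀ {Γ t u a T} → Γ ⊢ t ≈ u ∶⟨ a ⟩ T → Γ ⊢ t ≈ t ∶⟨ a ⟩ T
arg-reflˡ (arg-rel e)   = arg-rel (≈-reflˡ e)
arg-reflˡ (arg-irr e _) = arg-irr e e

≈-cast : ∀ {Γ t t' u u' T T'} → t ≡ t' → u ≡ u' → T ≡ T' → Γ ⊢ t ≈ u ∶ T → Γ ⊢ t' ≈ u' ∶ T'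
≈-cast refl refl refl e = e

≈-wf : ∀ {Γ t u T} → Γ ⊢ t ≈ u ∶ T → Wf Γ
≈-wf (≈-sort w)        = w
≈-wf (≈-var w _)       = w
≈-wf (≈-pi e _ _ _)    = ≈-wf e
≈-wf (≈-lam e _ _ _ _) = ≈-wf e
≈-wf (≈-app e _ _)     = ≈-wf e
≈-wf (≈-β e _ _ _ _)   = ≈-wf e
≈-wf (≈-η e _)         = ≈-wf e
≈-wf (≈-sym e)         = ≈-wf e
≈-wf (≈-trans e _)     = ≈-wf e
≈-wf (≈-conv e _)      = ≈-wf e

-- Proved once for an abstract notion of value: variables give renaming, and renaming supplies the
-- weakening that the instance with typed terms asks for.
module SubstitutionLemma
  (Val     : Ctx → Tm → Tm → Set)
  (Val-≈   : ∀ {Γ t A} → Wf Γ → Val Γ t A → Γ ⊢ t ≈ t ∶ A)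
  (Val-wk  : ∀ {Γ t A b} → Wf (Γ ▷ b) → Wf ((Γ ▷ b) ⊕) → Val Γ t A → Val (Γ ▷ b) (weaken t) (weaken A))
  (Val-var : ∀ {Γ A} → Wf (Γ ▷ (rel , A)) → Val (Γ ▷ (rel , A)) (var zero) (weaken A))
  where

  -- Irrelevant arguments are typed in `Γ ⊕`, so every variable, irrelevant ones included, has an
  -- image typed in `Δ ⊕`, while only relevant ones have an image typed in `Δ`. `wf⊕` is a field
  -- because deriving it from `wf` goes through renaming, an instance of this very module.
  record Sub (Δ : Ctx) (σ : ℕ → Tm) (Γ : Ctx) : Set where
    constructor mkSub
    field
      wf   : Wf Δ
      wf⊕  : Wf (Δ ⊕)
      val  : ∀ {x A} → Γ ∋ x ∶ A → Val Δ (σ x) (subst σ A)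
      val⊕ : ∀ {x A} → (Γ ⊕) ∋ x ∶ A → Val (Δ ⊕) (σ x) (subst σ A)
  open Sub public

  Sub-cong : ∀ {Δ σ τ Γ} → σ ≗ τ → Sub Δ σ Γ → Sub Δ τ Γ
  Sub-cong {Δ} {σ} {τ} e S = mkSub (wf S) (wf⊕ S)
    (λ {x} {A} i → go x A (val S i)) (λ {x} {A} i → go x A (val⊕ S i))
    where
    go : ∀ {Θ} x A → Val Θ (σ x) (subst σ A) → Val Θ (τ x) (subst τ A)
    go x A v rewrite e x | subst-cong e A = v

  -- Extending the target by `subst σ U` requires this type to be well formed in `Δ ⊕` as well.
  -- Applying this substitution to the derivation of `U` at hand gives that by structural recursion.
  Sub-⊕ˡ : ∀ {Δ σ Γ} → Sub Δ σ Γ → Sub (Δ ⊕) σ Γ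
  Sub-⊕ˡ {Δ} S = mkSub (wf⊕ S) (transport Wf (sym (⊕-idem Δ)) (wf⊕ S))
    (val⊕ S ∘ ∋-⊕) (transport (λ Θ → Val Θ _ _) (sym (⊕-idem Δ)) ∘ val⊕ S)

  Sub-⊕ : ∀ {Δ σ Γ} → Sub Δ σ Γ → Sub (Δ ⊕) σ (Γ ⊕)
  Sub-⊕ {Δ} {Γ = Γ} S = mkSub (wf⊕ S) (transport Wf (sym (⊕-idem Δ)) (wf⊕ S)) (val⊕ S)
    (λ {x} {A} i → transport (λ Θ → Val Θ _ _) (sym (⊕-idem Δ)) (val⊕ S (transport (λ Θ → Θ ∋ x ∶ A) (⊕-idem Γ) i)))

  -- Phrased through the tail `τ ∘ suc`, which computes for `exts σ`, for `u ∷ σ` and for `var`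
  -- alike.
  Sub-▷ : ∀ {Δ τ Γ a U} → Sub Δ (τ ∘ suc) Γ →
          (a ≡ rel → Val Δ (τ zero) (subst (τ ∘ suc) U)) → Val (Δ ⊕) (τ zero) (subst (τ ∘ suc) U) →
          Sub Δ τ (Γ ▷ (a , U))
  Sub-▷ {Δ} {τ} {Γ} {U = U} S v v⊕ = mkSub (wf S) (wf⊕ S)
    (λ { here              → transport (Val _ _) (sym (subst-rename (λ _ → refl) U)) (v refl)
       ; (there {U = A} i) → transport (Val _ _) (sym (subst-rename (λ _ → refl) A)) (val S i) })
    (λ { here              → transport (Val _ _) (sym (subst-rename (λ _ → refl) U)) v⊕
       ; (there {U = A} i) → transport (Val _ _) (sym (subst-rename (λ _ → refl) A)) (val⊕ S i) })

  Sub-weaken : ∀ {Δ σ Γ b} → Wf (Δ ▷ b) → Wf ((Δ ▷ b) ⊕) → Sub Δ σ Γ → Sub (Δ ▷ b) (weaken ∘ σ) Γ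
  Sub-weaken {Δ} {σ} {b = b} w w⊕ S = mkSub w w⊕
    (λ {_} {A} i → transport (Val _ _) (rename-subst (λ _ → refl) A) (Val-wk w w⊕ (val S i)))
    (λ {_} {A} i → transport (Val _ _) (rename-subst (λ _ → refl) A)
      (Val-wk w⊕ (transport Wf (sym (⊕-idem (Δ ▷ b))) w⊕) (val⊕ S i)))

  Sub-exts : ∀ {Δ σ Γ a U s} → Sub Δ σ Γ → Δ ⊢ subst σ U ≈ subst σ U ∶ sort s →
             Δ ⊕ ⊢ subst σ U ≈ subst σ U ∶ sort s → Sub (Δ ▷ (a , subst σ U)) (exts σ) (Γ ▷ (a , U))
  Sub-exts {U = U} S e e⊕ = Sub-▷ (Sub-weaken w w⊕ S)
    (λ { refl → transport (Val _ _) (rename-subst (λ _ → refl) U) (Val-var w) })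
    (transport (Val _ _) (rename-subst (λ _ → refl) U) (Val-var w⊕))
    where
    w  = wf-▷ (wf S) e
    w⊕ = wf-▷ (wf⊕ S) e⊕

  ≈-subst   : ∀ {Δ σ Γ t u T} → Sub Δ σ Γ → Γ ⊢ t ≈ u ∶ T → Δ ⊢ subst σ t ≈ subst σ u ∶ subst σ T
  arg-subst : ∀ {Δ σ Γ t u a T} → Sub Δ σ Γ → Γ ⊢ t ≈ u ∶⟨ a ⟩ T → Δ ⊢ subst σ t ≈ subst σ u ∶⟨ a ⟩ subst σ T
  Sub-lift  : ∀ {Δ σ Γ a U U' s} → Sub Δ σ Γ → Γ ⊢ U ≈ U' ∶ sort s →
              Sub (Δ ▷ (a , subst σ U)) (exts σ) (Γ ▷ (a , U))
  Sub-liftʳ : ∀ {Δ σ Γ a U U' s} → Sub Δ σ Γ → Γ ⊢ U' ≈ U ∶ sort s →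
              Sub (Δ ▷ (a , subst σ U)) (exts σ) (Γ ▷ (a , U))

  arg-subst S (arg-rel e)    = arg-rel (≈-subst S e)
  arg-subst S (arg-irr e e') = arg-irr (≈-subst (Sub-⊕ S) e) (≈-subst (Sub-⊕ S) e')

  Sub-lift  S e = Sub-exts S (≈-reflˡ (≈-subst S e)) (≈-reflˡ (≈-subst (Sub-⊕ˡ S) e))
  Sub-liftʳ S e = Sub-exts S (≈-reflʳ (≈-subst S e)) (≈-reflʳ (≈-subst (Sub-⊕ˡ S) e))

  ≈-subst S (≈-sort _)     = ≈-sort (wf S)
  ≈-subst S (≈-var _ i)    = Val-≈ (wf S) (val S i)
  ≈-subst S (≈-pi e f g r) =
    ≈-pi (≈-subst S e) (≈-subst (Sub-lift S e) f) (≈-subst (Sub-liftʳ S e) g) r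
  ≈-subst S (≈-lam e f g f' g') =
    ≈-lam (≈-subst S e) (≈-subst (Sub-lift S e) f) (≈-subst (Sub-lift S e) g)
          (≈-subst (Sub-liftʳ S e) f') (≈-subst (Sub-liftʳ S e) g')
  ≈-subst {σ = σ} S (≈-app {u = u} {u' = u'} {T = T} e f g) =
    ≈-cast refl refl (sym (subst-[] σ T u))
      (≈-app (≈-subst S e) (arg-subst S f)
        (≈-cast (subst-[] σ T u) (subst-[] σ T u') refl (≈-subst S g)))
  ≈-subst {σ = σ} S (≈-β {t = t} {T = T} {u = u} e f g h k) =
    ≈-cast refl (sym (subst-[] σ t u)) (sym (subst-[] σ T u))
      (≈-β (≈-subst S e) (≈-subst (Sub-lift S e) f) (≈-subst (Sub-lift S e) g) (arg-subst S h)
        (≈-cast (subst-[] σ t u) (subst-[] σ t u) (subst-[] σ T u) (≈-subst S k)))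
  ≈-subst {σ = σ} S (≈-η {a = a} {U = U} {t = t} e f) =
    ≈-cast refl (sym q) refl (≈-η (≈-subst S e) (≈-cast q q refl (≈-subst S f)))
    where q = cong (λ v → lam a (subst σ U) (app a v (var zero))) (subst-exts-weaken t)
  ≈-subst S (≈-sym e)     = ≈-sym (≈-subst S e)
  ≈-subst S (≈-trans e f) = ≈-trans (≈-subst S e) (≈-subst S f)
  ≈-subst S (≈-conv e f)  = ≈-conv (≈-subst S e) (≈-subst S f)

-- Renamings, resurrection and typed substitutions

IsVar : Ctx → Tm → Tm → Set
IsVar Γ t A = ∃[ y ] (t ≡ var y × Γ ∋ y ∶ A)

IsVar-≈ : ∀ {Γ t A} → Wf Γ → IsVar Γ t A → Γ ⊢ t ≈ t ∶ A
IsVar-≈ w (_ , refl , i) = ≈-var w i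

IsVar-wk : ∀ {Γ t A b} → Wf (Γ ▷ b) → Wf ((Γ ▷ b) ⊕) → IsVar Γ t A → IsVar (Γ ▷ b) (weaken t) (weaken A)
IsVar-wk _ _ (_ , refl , i) = _ , refl , there i

IsVar-var : ∀ {Γ A} → Wf (Γ ▷ (rel , A)) → IsVar (Γ ▷ (rel , A)) (var zero) (weaken A)
IsVar-var _ = _ , refl , here

module Renaming = SubstitutionLemma IsVar IsVar-≈ IsVar-wk IsVar-var

Ren : Ctx → (ℕ → ℕ) → Ctx → Set
Ren Δ ρ Γ = Renaming.Sub Δ (var ∘ ρ) Γ

≈-rename : ∀ {Δ ρ Γ t u T} → Ren Δ ρ Γ → Γ ⊢ t ≈ u ∶ T → Δ ⊢ rename ρ t ≈ rename ρ u ∶ rename ρ T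
≈-rename {t = t} {u} {T} r e =
  ≈-cast (sym (rename≡subst (λ _ → refl) t)) (sym (rename≡subst (λ _ → refl) u))
         (sym (rename≡subst (λ _ → refl) T)) (Renaming.≈-subst r e)

∋-subst-var : ∀ {Γ x A} → Γ ∋ x ∶ A → ∃[ y ] (var x ≡ var y × Γ ∋ y ∶ subst var A)
∋-subst-var {A = A} i = _ , refl , transport (λ B → _ ∋ _ ∶ B) (sym (subst-id (λ _ → refl) A)) i

-- Resurrection is handled as the identity renaming from `Γ` into `Γ ⊕`. The two statements are
-- mutual: that renaming needs `Γ ⊕` to be well formed, and each entry of `Γ ⊕` is typed by
-- renaming.
Wf-⊕ : ∀ {Γ} → Wf Γ → Wf (Γ ⊕)
Ren-⊕ : ∀ {Γ} → Wf Γ → Ren (Γ ⊕) (λ x → x) Γ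

Wf-⊕ wf-ε = wf-ε
Wf-⊕ (wf-▷ {T = T} w e) =
  wf-▷ (Wf-⊕ w) (≈-cast (subst-id (λ _ → refl) T) (subst-id (λ _ → refl) T) refl (Renaming.≈-subst (Ren-⊕ w) e))

Ren-⊕ {Γ} w = Renaming.mkSub (Wf-⊕ w) (transport Wf (sym (⊕-idem Γ)) (Wf-⊕ w))
  (∋-subst-var ∘ ∋-⊕) (∋-subst-var ∘ ∋-⊕)

≈-⊕ : ∀ {Γ t u T} → Γ ⊢ t ≈ u ∶ T → Γ ⊕ ⊢ t ≈ u ∶ T
≈-⊕ {t = t} {u} {T} e = ≈-cast (subst-id (λ _ → refl) t) (subst-id (λ _ → refl) u) (subst-id (λ _ → refl) T)
  (Renaming.≈-subst (Ren-⊕ (≈-wf e)) e)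

Ren-id : ∀ {Γ} → Wf Γ → Ren Γ (λ x → x) Γ
Ren-id w = Renaming.mkSub w (Wf-⊕ w) ∋-subst-var ∋-subst-var

Ren-suc : ∀ {Γ b} → Wf (Γ ▷ b) → Ren (Γ ▷ b) suc Γ
Ren-suc w@(wf-▷ w' _) = Renaming.Sub-weaken w (Wf-⊕ w) (Ren-id w')

Ren-∘ : ∀ {Θ Δ Γ ρ' ρ} → Ren Θ ρ' Δ → Ren Δ ρ Γ → Ren Θ (ρ' ∘ ρ) Γ
Ren-∘ {ρ' = ρ'} {ρ} r' r = Renaming.mkSub (Renaming.wf r') (Renaming.wf⊕ r') 
  (λ {_} {A} i → go A (Renaming.val r') (Renaming.val r i))
  (λ {_} {A} i → go A (Renaming.val⊕ r') (Renaming.val⊕ r i))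
  where
  go : ∀ {Γ Γ' x} A → (∀ {y B} → Γ ∋ y ∶ B → ∃[ z ] (var (ρ' y) ≡ var z × Γ' ∋ z ∶ subst (var ∘ ρ') B)) →
       ∃[ y ] (var (ρ x) ≡ var y × Γ ∋ y ∶ subst (var ∘ ρ) A) →
       ∃[ z ] (var (ρ' (ρ x)) ≡ var z × Γ' ∋ z ∶ subst (var ∘ ρ' ∘ ρ) A)
  go A f (_ , refl , i) with f i
  ... | _ , refl , j = _ , refl , transport (λ B → _ ∋ _ ∶ B) (subst-subst (λ _ → refl) A) j

Ren-ext : ∀ {Δ ρ Γ a U s} → Ren Δ ρ Γ → Γ ⊢ U ≈ U ∶ sort s → Ren (Δ ▷ (a , rename ρ U)) (ext ρ) (Γ ▷ (a , U))
Ren-ext {Δ} {ρ} {a = a} {U} r e =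
  transport (λ V → Renaming.Sub (Δ ▷ (a , V)) _ _) (sym (rename≡subst (λ _ → refl) U))
    (Renaming.Sub-cong (λ { zero → refl ; (suc n) → refl }) (Renaming.Sub-lift r e))

IsTyped : Ctx → Tm → Tm → Set
IsTyped Γ t A = Γ ⊢ t ≈ t ∶ A

IsTyped-≈ : ∀ {Γ t A} → Wf Γ → IsTyped Γ t A → Γ ⊢ t ≈ t ∶ A
IsTyped-≈ _ e = e

IsTyped-wk : ∀ {Γ t A b} → Wf (Γ ▷ b) → Wf ((Γ ▷ b) ⊕) → IsTyped Γ t A → IsTyped (Γ ▷ b) (weaken t) (weaken A)
IsTyped-wk w _ e = ≈-rename (Ren-suc w) e

IsTyped-var : ∀ {Γ A} → Wf (Γ ▷ (rel , A)) → IsTyped (Γ ▷ (rel , A)) (var zero) (weaken A)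
IsTyped-var w = ≈-var w here

module Substitution = SubstitutionLemma IsTyped IsTyped-≈ IsTyped-wk IsTyped-var

Sub-id : ∀ {Γ} → Wf Γ → Substitution.Sub Γ var Γ
Sub-id w = Substitution.mkSub w (Wf-⊕ w) (go w) (go (Wf-⊕ w))
  where
  go : ∀ {Γ x A} → Wf Γ → Γ ∋ x ∶ A → Γ ⊢ var x ≈ var x ∶ subst var A
  go {A = A} w i = ≈-cast refl refl (sym (subst-id (λ _ → refl) A)) (≈-var w i)

Sub-rename : ∀ {Θ Δ Γ ρ σ} → Ren Θ ρ Δ → Substitution.Sub Δ σ Γ → Substitution.Sub Θ (rename ρ ∘ σ) Γ
Sub-rename r S = Substitution.mkSub (Renaming.wf r) (Renaming.wf⊕ r)
  (λ {_} {A} i → ≈-cast refl refl (rename-subst (λ _ → refl) A) (≈-rename r (Substitution.val S i)))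
  (λ {_} {A} i → ≈-cast refl refl (rename-subst (λ _ → refl) A) (≈-rename (Renaming.Sub-⊕ r) (Substitution.val⊕ S i)))

Sub-∷ : ∀ {Δ τ Γ a U v} → Substitution.Sub Δ (τ ∘ suc) Γ →
        Δ ⊢ τ zero ≈ v ∶⟨ a ⟩ subst (τ ∘ suc) U → Substitution.Sub Δ τ (Γ ▷ (a , U))
Sub-∷ S (arg-rel e)   = Substitution.Sub-▷ S (λ _ → ≈-reflˡ e) (≈-⊕ (≈-reflˡ e))
Sub-∷ S (arg-irr e _) = Substitution.Sub-▷ S (λ ()) e

arg-conv : ∀ {Γ t u a A B s} → Γ ⊢ t ≈ u ∶⟨ a ⟩ A → Γ ⊢ A ≈ B ∶ sort s → Γ ⊢ t ≈ u ∶⟨ a ⟩ B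
arg-conv (arg-rel e)    f = arg-rel (≈-conv e f)
arg-conv (arg-irr e e') f = arg-irr (≈-conv e (≈-⊕ f)) (≈-conv e' (≈-⊕ f))

≈-[] : ∀ {Γ a U t t' u T} → Γ ▷ (a , U) ⊢ t ≈ t' ∶ T → Γ ⊢ u ≈ u ∶⟨ a ⟩ U → Γ ⊢ t [ u ] ≈ t' [ u ] ∶ T [ u ]
≈-[] {U = U} e f with ≈-wf e
... | wf-▷ w _ = Substitution.≈-subst
  (Sub-∷ (Sub-id w) (transport (λ A → _ ⊢ _ ≈ _ ∶⟨ _ ⟩ A) (sym (subst-id (λ _ → refl) U)) f)) e

arg-var : ∀ {Γ a U} → Wf (Γ ▷ (a , U)) → Γ ▷ (a , U) ⊢ var zero ≈ var zero ∶⟨ a ⟩ weaken U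
arg-var {a = rel} w = arg-rel (≈-var w here)
arg-var {a = irr} w = arg-irr (≈-var (Wf-⊕ w) here) (≈-var (Wf-⊕ w) here)

-- An instance of substitution: the identity, with the last variable retyped by conversion.
≈-context : ∀ {Γ a U V t u T s} → Γ ⊢ U ≈ V ∶ sort s → Γ ▷ (a , U) ⊢ t ≈ u ∶ T → Γ ▷ (a , V) ⊢ t ≈ u ∶ T
≈-context {Γ} {a} {U} {V} {t} {u} {T} e f =
  ≈-cast (subst-id (λ _ → refl) t) (subst-id (λ _ → refl) u) (subst-id (λ _ → refl) T)
    (Substitution.≈-subst (Sub-∷ {τ = var} (Sub-rename (Ren-suc w) (Sub-id (≈-wf e)))
      (transport (λ A → _ ⊢ _ ≈ _ ∶⟨ _ ⟩ A) (rename≡subst (λ _ → refl) U)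
        (arg-conv (arg-var w) (≈-rename (Ren-suc w) (≈-sym e))))) f)
  where
  w : Wf (Γ ▷ (a , V))
  w = wf-▷ (≈-wf e) (≈-reflʳ e)

-- Weak head reduction

infix 4 _⇝_ _⇝*_ _⊢_⇘_∶_

data _⇝_ : Tm → Tm → Set where
  β : ∀ {a U t u} → app a (lam a U t) u ⇝ t [ u ]
  ξ : ∀ {a t t' u} → t ⇝ t' → app a t u ⇝ app a t' u

_⇝*_ : Tm → Tm → Set
_⇝*_ = Star _⇝_

data Ne : Tm → Set where
  var : ∀ {n} → Ne (var n)
  app : ∀ {a t u} → Ne t → Ne (app a t u)

-- λ-abstractions are omitted because only types are ever brought to weak head normal form.
data Whnf : Tm → Set where
  sort : ∀ {s} → Whnf (sort s)
  pi   : ∀ {a s₁ s₂ U T} → Whnf (Pi a s₁ s₂ U T)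
  ne   : ∀ {N} → Ne N → Whnf N

ne-stuck : ∀ {N t} → Ne N → ¬ (N ⇝ t)
ne-stuck (app n) (ξ r) = ne-stuck n r

whnf-stuck : ∀ {N t} → Whnf N → ¬ (N ⇝ t)
whnf-stuck (ne n) r = ne-stuck n r

⇝-det : ∀ {t u v} → t ⇝ u → t ⇝ v → u ≡ v
⇝-det β     β      = refl
⇝-det (ξ r) (ξ r') = cong (λ t → app _ t _) (⇝-det r r')

whnf-unique : ∀ {A N M} → A ⇝* N → A ⇝* M → Whnf N → Whnf M → N ≡ M
whnf-unique done     done       _ _ = refl
whnf-unique done     (r ◅ _)    n _ = ⊥-elim (whnf-stuck n r)
whnf-unique (r ◅ _)  done       _ m = ⊥-elim (whnf-stuck m r)
whnf-unique (r ◅ rs) (r' ◅ rs') n m rewrite ⇝-det r r' = whnf-unique rs rs' n m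

⇝-rename : ∀ {t u} ρ → t ⇝ u → rename ρ t ⇝ rename ρ u
⇝-rename ρ (β {a} {U} {t} {u}) = transport (rename ρ (app a (lam a U t) u) ⇝_) (sym (rename-[] ρ t u)) β
⇝-rename ρ (ξ r)               = ξ (⇝-rename ρ r)

⇝*-rename : ∀ {t u} ρ → t ⇝* u → rename ρ t ⇝* rename ρ u
⇝*-rename ρ = gmap (rename ρ) (⇝-rename ρ)

Ne-rename : ∀ {N} ρ → Ne N → Ne (rename ρ N)
Ne-rename ρ var     = var
Ne-rename ρ (app n) = app (Ne-rename ρ n)

-- Reduction is untyped and carries its equality along, because subject reduction would already
-- require injectivity of `Pi`.
record _⊢_⇘_∶_ (Γ : Ctx) (A N : Tm) (s : Sort) : Set where
  constructor _,_
  field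
    red : A ⇝* N
    eq  : Γ ⊢ A ≈ N ∶ sort s
open _⊢_⇘_∶_

⇘-refl : ∀ {Γ A s} → Γ ⊢ A ≈ A ∶ sort s → Γ ⊢ A ⇘ A ∶ s
⇘-refl e = done , e

⇘-expand : ∀ {Γ A A' N s} → A ⇝* A' → Γ ⊢ A ≈ A' ∶ sort s → Γ ⊢ A' ⇘ N ∶ s → Γ ⊢ A ⇘ N ∶ s
⇘-expand rs e (rs' , e') = rs ◅◅ rs' , ≈-trans e e'

⇘-rename : ∀ {Δ ρ Γ A N s} → Ren Δ ρ Γ → Γ ⊢ A ⇘ N ∶ s → Δ ⊢ rename ρ A ⇘ rename ρ N ∶ s
⇘-rename r (rs , e) = ⇝*-rename _ rs , ≈-rename r e

-- Logical relation

-- Ty k V relates types all of whose universes are below k and interpreted by V.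
Univ : ℕ → Set₁
Univ k = ∀ {i} → i <′ k → Ctx → Tm → Tm → Set

data Ty (k : ℕ) (V : Univ k) : Sort → Ctx → Tm → Tm → Set
data Dom (k : ℕ) (V : Univ k) : Ann → Sort → Ctx → Tm → Tm → Set
-- Defined with `Ty` by induction-recursion, since `𝓖` quantifies over elements of `𝓕`. `El′` is the
-- part that depends on the shape of the type; `El` adds the judgemental equality, which can then be
-- projected.
El  : ∀ {k} {V : Univ k} {s Γ A B} → Ty k V s Γ A B → Tm → Tm → Set
El′ : ∀ {k} {V : Univ k} {s Γ A B} → Ty k V s Γ A B → Tm → Tm → Set
ElD : ∀ {k} {V : Univ k} {a s Γ A B} → Dom k V a s Γ A B → Tm → Tm → Set

data Ty k V where
  sort : ∀ {s Γ A B i} (p : i <′ k) → Γ ⊢ A ⇘ sort (𝕊 i) ∶ s → Γ ⊢ B ⇘ sort (𝕊 i) ∶ s → Ty k V s Γ A B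
  ne   : ∀ {s Γ A B N M} → Ne N → Ne M → Γ ⊢ A ⇘ N ∶ s → Γ ⊢ B ⇘ M ∶ s → Γ ⊢ N ≈ M ∶ sort s → Ty k V s Γ A B
  pi   : ∀ {s Γ A B a s₁ s₂ F F' G G'} →
         Γ ⊢ A ⇘ Pi a s₁ s₂ F G ∶ s → Γ ⊢ B ⇘ Pi a s₁ s₂ F' G' ∶ s →
         Γ ⊢ Pi a s₁ s₂ F G ≈ Pi a s₁ s₂ F' G' ∶ sort s →
         -- Injectivity reads off these two equations. Storing them avoids recovering the codomain
         -- equation from `𝓖` at a fresh variable.
         Γ ⊢ F ≈ F' ∶ sort s₁ → Γ ▷ (a , F) ⊢ G ≈ G' ∶ sort s₂ →
         (𝓕 : ∀ {Δ ρ} → Ren Δ ρ Γ → Dom k V a s₁ Δ (rename ρ F) (rename ρ F')) →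
         (𝓖 : ∀ {Δ ρ x y} (r : Ren Δ ρ Γ) → ElD (𝓕 r) x y →
              Ty k V s₂ Δ (rename (ext ρ) G [ x ]) (rename (ext ρ) G' [ y ])) →
         Ty k V s Γ A B

data Dom k V where
  rel : ∀ {s Γ A B} → Ty k V s Γ A B → Dom k V rel s Γ A B
  irr : ∀ {s Γ A B} → Γ ⊢ A ≈ B ∶ sort s → Dom k V irr s Γ A B

El {Γ = Γ} {A = A} 𝓐 t u = (Γ ⊢ t ≈ u ∶ A) × El′ 𝓐 t u

El′ {V = V} {Γ = Γ} (sort p _ _) t u = V p Γ t u
El′ (ne _ _ _ _ _) t u = ⊤
El′ {Γ = Γ} (pi {a = a} _ _ _ _ _ 𝓕 𝓖) t u =
  ∀ {Δ ρ x y} (r : Ren Δ ρ Γ) (xy : ElD (𝓕 r) x y) →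
  El (𝓖 r xy) (app a (rename ρ t) x) (app a (rename ρ u) y)

ElD (rel 𝓐) x y = El 𝓐 x y
ElD {Γ = Γ} {A = A} (irr _) x y = (Γ ⊕ ⊢ x ≈ x ∶ A) × (Γ ⊕ ⊢ y ≈ y ∶ A)

-- Raising the bound to `suc k` adds one universe, `𝕊 k`, interpreted by the types over the bound
-- `k`. The two constructors of `≤′` follow exactly this recursion.
𝓤 : ∀ k → Univ k
𝓤 (suc k) (≤′-reflexive refl) = Ty k (𝓤 k) (𝕊 k)
𝓤 (suc k) (≤′-step p)         = 𝓤 k p

TY : ℕ → Sort → Ctx → Tm → Tm → Set
TY k = Ty k (𝓤 k)

DOM : ℕ → Ann → Sort → Ctx → Tm → Tm → Set
DOM k = Dom k (𝓤 k)

𝓤-unfold : ∀ k {i} (p : i <′ k) → 𝓤 k p ≡ TY i (𝕊 i)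
𝓤-unfold (suc k) (≤′-reflexive refl) = refl
𝓤-unfold (suc k) (≤′-step p)         = 𝓤-unfold k p

𝓤-irrelevant : ∀ {k k' i} (p : i <′ k) (p' : i <′ k') → 𝓤 k p ≡ 𝓤 k' p'
𝓤-irrelevant p p' = trans (𝓤-unfold _ p) (sym (𝓤-unfold _ p'))

-- Escape, independence of the derivation, symmetry and transitivity

escape : ∀ {k s Γ A B} → TY k s Γ A B → Γ ⊢ A ≈ B ∶ sort s
escape (sort _ (_ , e) (_ , e'))     = ≈-trans e (≈-sym e')
escape (ne _ _ (_ , e) (_ , e') f)   = ≈-trans e (≈-trans f (≈-sym e'))
escape (pi (_ , e) (_ , e') f _ _ _ _) = ≈-trans e (≈-trans f (≈-sym e'))

escapeD : ∀ {k a s Γ A B} → DOM k a s Γ A B → Γ ⊢ A ≈ B ∶ sort s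
escapeD (rel 𝓐) = escape 𝓐
escapeD (irr e) = e

ElD-arg : ∀ {k a s Γ A B x y} (𝓓 : DOM k a s Γ A B) → ElD 𝓓 x y → Γ ⊢ x ≈ y ∶⟨ a ⟩ A
ElD-arg (rel 𝓐) (e , _)  = arg-rel e
ElD-arg (irr _) (e , e') = arg-irr e e'

-- The ways in which the pairs `(A , B)` and `(C , D)` can have an endpoint in common.
data Share : Tm → Tm → Tm → Tm → Set where
  left  : ∀ {A B D} → Share A B A D
  right : ∀ {A B C} → Share A B C B
  inner : ∀ {A B D} → Share A B B D
  outer : ∀ {A B C} → Share A B C A

Share-≈ : ∀ {Γ A B C D s s' t u} → Share A B C D → Γ ⊢ A ≈ B ∶ sort s → Γ ⊢ C ≈ D ∶ sort s' →
          Γ ⊢ t ≈ u ∶ A → Γ ⊢ t ≈ u ∶ C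
Share-≈ left  _ _ e = e
Share-≈ right f g e = ≈-conv (≈-conv e f) (≈-sym g)
Share-≈ inner f _ e = ≈-conv e f
Share-≈ outer _ g e = ≈-conv e (≈-sym g)

-- Weak head reduction is deterministic, so a common endpoint has a single normal form. This aligns
-- the shapes of two derivations and refutes the mixed cases.
Share-whnf : ∀ {Γ A B C D N N' M M' s s'} → Share A B C D →
  Γ ⊢ A ⇘ N ∶ s → Γ ⊢ B ⇘ N' ∶ s → Γ ⊢ C ⇘ M ∶ s' → Γ ⊢ D ⇘ M' ∶ s' →
  Whnf N → Whnf N' → Whnf M → Whnf M' → Share N N' M M'
Share-whnf left  a b c d n n' m m' with refl ← whnf-unique (red a) (red c) n m = left
Share-whnf right a b c d n n' m m' with refl ← whnf-unique (red b) (red d) n' m' = right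
Share-whnf inner a b c d n n' m m' with refl ← whnf-unique (red b) (red c) n' m = inner
Share-whnf outer a b c d n n' m m' with refl ← whnf-unique (red a) (red d) n m' = outer

-- What the lemmas below assume of every universe under the bound. `props` discharges it by
-- recursion on the bound, because the laws of the universe `𝕊 k` are those of `Ty k`.
record UnivProps (i : ℕ) (V : Ctx → Tm → Tm → Set) : Set where
  field
    V-sym    : ∀ {Γ A B} → V Γ A B → V Γ B A
    V-trans  : ∀ {Γ A B C} → V Γ A B → V Γ B C → V Γ A C
    V-rename : ∀ {Δ ρ Γ A B} → Ren Δ ρ Γ → V Γ A B → V Δ (rename ρ A) (rename ρ B)
    V-expand : ∀ {Γ A A' B} → A ⇝* A' → Γ ⊢ A ≈ A' ∶ sort (𝕊 i) → V Γ A' B → V Γ A B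
    V-ne     : ∀ {Γ N M} → Ne N → Ne M → Γ ⊢ N ≈ M ∶ sort (𝕊 i) → V Γ N M
open UnivProps

Props : ℕ → Set
Props k = ∀ {i} (p : i <′ k) → UnivProps i (𝓤 k p)

-- Mutual with symmetry and transitivity: changing the pair of types at `Pi` can require the
-- reflexive argument `(y , y)`, which these two provide, and they in turn must move results between
-- fibres.
El-irrelevant : ∀ {k k' s s' Γ A B C D t u} → Props k → Props k' →
  (𝓐 : TY k s Γ A B) (𝓑 : TY k' s' Γ C D) → Share A B C D → El 𝓐 t u → El 𝓑 t u
ElD-irrelevant : ∀ {k k' a s s' Γ A B C D t u} → Props k → Props k' →
  (𝓐 : DOM k a s Γ A B) (𝓑 : DOM k' a s' Γ C D) → Share A B C D → ElD 𝓐 t u → ElD 𝓑 t u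
El-sym    : ∀ {k s Γ A B t u} → Props k → (𝓐 : TY k s Γ A B) → El 𝓐 t u → El 𝓐 u t
ElD-sym   : ∀ {k a s Γ A B t u} → Props k → (𝓐 : DOM k a s Γ A B) → ElD 𝓐 t u → ElD 𝓐 u t
El-trans  : ∀ {k s Γ A B t u v} → Props k → (𝓐 : TY k s Γ A B) → El 𝓐 t u → El 𝓐 u v → El 𝓐 t v
ElD-trans : ∀ {k a s Γ A B t u v} → Props k → (𝓐 : DOM k a s Γ A B) → ElD 𝓐 t u → ElD 𝓐 u v → ElD 𝓐 t v
ElD-reflʳ : ∀ {k a s Γ A B t u} → Props k → (𝓐 : DOM k a s Γ A B) → ElD 𝓐 t u → ElD 𝓐 u u

ElD-reflʳ h 𝓐 e = ElD-trans h 𝓐 (ElD-sym h 𝓐 e) e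

ElD-sym h (rel 𝓐) e        = El-sym h 𝓐 e
ElD-sym h (irr _) (e , e') = e' , e

ElD-trans h (rel 𝓐) e f               = El-trans h 𝓐 e f
ElD-trans h (irr _) (e , _) (_ , e') = e , e'

ElD-irrelevant h h' (rel 𝓐) (rel 𝓑) sh e        = El-irrelevant h h' 𝓐 𝓑 sh e
ElD-irrelevant h h' (irr f) (irr g) sh (e , e') =
  Share-≈ sh (≈-⊕ f) (≈-⊕ g) e , Share-≈ sh (≈-⊕ f) (≈-⊕ g) e'

El-sym h (sort p _ _)   (e , v) = ≈-sym e , V-sym (h p) v
El-sym h (ne _ _ _ _ _) (e , _) = ≈-sym e , tt
El-sym h (pi _ _ _ _ _ 𝓕 𝓖) (e , f) = ≈-sym e , λ r xy →
  -- The fibres at `(y , x)` and `(x , y)` need not share an endpoint. The one at `(y , y)` has its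
  -- left end in common with the former and its right end with the latter.
  let yx = ElD-sym h (𝓕 r) xy
      yy = ElD-reflʳ h (𝓕 r) xy
  in El-irrelevant h h (𝓖 r yy) (𝓖 r xy) right
       (El-irrelevant h h (𝓖 r yx) (𝓖 r yy) left (El-sym h (𝓖 r yx) (f r yx)))

El-trans h (sort p _ _)   (e , v) (e' , v') = ≈-trans e e' , V-trans (h p) v v'
El-trans h (ne _ _ _ _ _) (e , _) (e' , _)  = ≈-trans e e' , tt
El-trans h (pi _ _ _ _ _ 𝓕 𝓖) (e , f) (e' , f') = ≈-trans e e' , λ r xy →
  -- The second hypothesis is used at `(y , y)`, so that `t x`, `u y` and `v y` form a chain.
  let yy = ElD-reflʳ h (𝓕 r) xy
  in El-trans h (𝓖 r xy) (f r xy) (El-irrelevant h h (𝓖 r yy) (𝓖 r xy) right (f' r yy))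

El-irrelevant h h' 𝓐@(sort p a b) 𝓑@(sort p' c d) sh (e , v)
  with Share-whnf sh a b c d sort sort sort sort
... | left  = Share-≈ sh (escape 𝓐) (escape 𝓑) e , transport (λ V → V _ _ _) (𝓤-irrelevant p p') v
... | right = Share-≈ sh (escape 𝓐) (escape 𝓑) e , transport (λ V → V _ _ _) (𝓤-irrelevant p p') v
... | inner = Share-≈ sh (escape 𝓐) (escape 𝓑) e , transport (λ V → V _ _ _) (𝓤-irrelevant p p') v
... | outer = Share-≈ sh (escape 𝓐) (escape 𝓑) e , transport (λ V → V _ _ _) (𝓤-irrelevant p p') v
El-irrelevant h h' 𝓐@(ne _ _ _ _ _) 𝓑@(ne _ _ _ _ _) sh (e , _) = Share-≈ sh (escape 𝓐) (escape 𝓑) e , tt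
El-irrelevant h h' 𝓐@(pi a b _ _ _ 𝓕₁ 𝓖₁) 𝓑@(pi c d _ _ _ 𝓕₂ 𝓖₂) sh (e , f)
  with Share-whnf sh a b c d pi pi pi pi
... | left = Share-≈ sh (escape 𝓐) (escape 𝓑) e , λ r xy →
      let xy' = ElD-irrelevant h' h (𝓕₂ r) (𝓕₁ r) left xy
      in El-irrelevant h h' (𝓖₁ r xy') (𝓖₂ r xy) left (f r xy')
... | right = Share-≈ sh (escape 𝓐) (escape 𝓑) e , λ r xy →
      let xy' = ElD-irrelevant h' h (𝓕₂ r) (𝓕₁ r) right xy
      in El-irrelevant h h' (𝓖₁ r xy') (𝓖₂ r xy) right (f r xy')
... | inner = Share-≈ sh (escape 𝓐) (escape 𝓑) e , λ r xy →
      -- The family common to both derivations is evaluated at `y` in one fibre and at `x` in the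
      -- other; the detour through `(y , y)` brings the evaluations together. The `outer` case is
      -- the mirror image, with the detour taken in the first derivation.
      let xy' = ElD-irrelevant h' h (𝓕₂ r) (𝓕₁ r) outer xy
          yy  = ElD-reflʳ h' (𝓕₂ r) xy
      in El-irrelevant h' h' (𝓖₂ r yy) (𝓖₂ r xy) right
           (El-irrelevant h h' (𝓖₁ r xy') (𝓖₂ r yy) inner (f r xy'))
... | outer = Share-≈ sh (escape 𝓐) (escape 𝓑) e , λ r xy →
      let xy' = ElD-irrelevant h' h (𝓕₂ r) (𝓕₁ r) inner xy
          yy' = ElD-reflʳ h (𝓕₁ r) xy'
      in El-irrelevant h h' (𝓖₁ r yy') (𝓖₂ r xy) outer
           (El-irrelevant h h (𝓖₁ r xy') (𝓖₁ r yy') right (f r xy'))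
El-irrelevant h h' (sort _ a b) (ne n m c d _) sh _
  with Share-whnf sh a b c d sort sort (ne n) (ne m)
El-irrelevant h h' (sort _ a b) (ne () _ c d _) sh _ | left
El-irrelevant h h' (sort _ a b) (ne () _ c d _) sh _ | inner
El-irrelevant h h' (sort _ a b) (ne _ () c d _) sh _ | right
El-irrelevant h h' (sort _ a b) (ne _ () c d _) sh _ | outer
El-irrelevant h h' (pi a b _ _ _ _ _) (ne n m c d _) sh _
  with Share-whnf sh a b c d pi pi (ne n) (ne m)
El-irrelevant h h' (pi a b _ _ _ _ _) (ne () _ c d _) sh _ | left
El-irrelevant h h' (pi a b _ _ _ _ _) (ne () _ c d _) sh _ | inner
El-irrelevant h h' (pi a b _ _ _ _ _) (ne _ () c d _) sh _ | right
El-irrelevant h h' (pi a b _ _ _ _ _) (ne _ () c d _) sh _ | outer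
El-irrelevant h h' (ne n m a b _) (sort _ c d) sh _
  with Share-whnf sh a b c d (ne n) (ne m) sort sort
El-irrelevant h h' (ne () _ a b _) (sort _ c d) sh _ | left
El-irrelevant h h' (ne _ () a b _) (sort _ c d) sh _ | inner
El-irrelevant h h' (ne _ () a b _) (sort _ c d) sh _ | right
El-irrelevant h h' (ne () _ a b _) (sort _ c d) sh _ | outer
El-irrelevant h h' (ne n m a b _) (pi c d _ _ _ _ _) sh _
  with Share-whnf sh a b c d (ne n) (ne m) pi pi
El-irrelevant h h' (ne () _ a b _) (pi c d _ _ _ _ _) sh _ | left
El-irrelevant h h' (ne _ () a b _) (pi c d _ _ _ _ _) sh _ | inner
El-irrelevant h h' (ne _ () a b _) (pi c d _ _ _ _ _) sh _ | right
El-irrelevant h h' (ne () _ a b _) (pi c d _ _ _ _ _) sh _ | outer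
El-irrelevant h h' (sort _ a b) (pi c d _ _ _ _ _) sh _
  with () ← Share-whnf sh a b c d sort sort pi pi
El-irrelevant h h' (pi a b _ _ _ _ _) (sort _ c d) sh _
  with () ← Share-whnf sh a b c d pi pi sort sort

Ty-sym : ∀ {k s Γ A B} → Props k → TY k s Γ A B → TY k s Γ B A
Dom-sym : ∀ {k a s Γ A B} → Props k → DOM k a s Γ A B → DOM k a s Γ B A

Dom-sym h (rel 𝓐) = rel (Ty-sym h 𝓐)
Dom-sym h (irr e) = irr (≈-sym e)

Ty-sym h (sort p a b)   = sort p b a
Ty-sym h (ne n m a b e) = ne m n b a (≈-sym e)
Ty-sym h (pi a b e f g 𝓕 𝓖) =
  pi b a (≈-sym e) (≈-sym f) (≈-context f (≈-sym g)) (λ r → Dom-sym h (𝓕 r)) λ r xy →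
    Ty-sym h (𝓖 r (ElD-sym h (𝓕 r) (ElD-irrelevant h h (Dom-sym h (𝓕 r)) (𝓕 r) inner xy)))

Ty-trans : ∀ {k k' s Γ A B C} → Props k → Props k' → TY k s Γ A B → TY k' s Γ B C → TY k s Γ A C
Dom-trans : ∀ {k k' a s Γ A B C} → Props k → Props k' → DOM k a s Γ A B → DOM k' a s Γ B C → DOM k a s Γ A C

Dom-trans h h' (rel 𝓐) (rel 𝓑) = rel (Ty-trans h h' 𝓐 𝓑)
Dom-trans h h' (irr e) (irr f) = irr (≈-trans e f)

Ty-trans h h' (sort p a b) (sort _ c d)
  with refl ← whnf-unique (red b) (red c) sort sort = sort p a d
Ty-trans h h' (ne n m a b e) (ne n' m' c d f)
  with refl ← whnf-unique (red b) (red c) (ne m) (ne n') = ne n m' a d (≈-trans e f)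
Ty-trans h h' (pi a b e f g 𝓕 𝓖) (pi c d e' f' g' 𝓕' 𝓖')
  with refl ← whnf-unique (red b) (red c) pi pi =
  pi a d (≈-trans e e') (≈-trans f f') (≈-trans g (≈-context (≈-sym f) g')) 𝓕'' λ r xy →
    -- The middle family is to be evaluated at `y` on both sides, hence `𝓖` at `(x , y)` and `𝓖'` at
    -- `(y , y)`.
    let xy' = ElD-irrelevant h h (𝓕'' r) (𝓕 r) left xy
        yy  = ElD-reflʳ h' (𝓕' r) (ElD-irrelevant h h' (𝓕 r) (𝓕' r) inner xy')
    in Ty-trans h h' (𝓖 r xy') (𝓖' r yy)
  where 𝓕'' = λ {Δ} {ρ} (r : Ren Δ ρ _) → Dom-trans h h' (𝓕 r) (𝓕' r)
Ty-trans h h' (sort _ _ b) (ne n _ c _ _) with refl ← whnf-unique (red b) (red c) sort (ne n) with () ← n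
Ty-trans h h' (pi _ b _ _ _ _ _) (ne n _ c _ _) with refl ← whnf-unique (red b) (red c) pi (ne n) with () ← n
Ty-trans h h' (ne _ m _ b _) (sort _ c _) with refl ← whnf-unique (red b) (red c) (ne m) sort with () ← m
Ty-trans h h' (ne _ m _ b _) (pi c _ _ _ _ _ _) with refl ← whnf-unique (red b) (red c) (ne m) pi with () ← m
Ty-trans h h' (sort _ _ b) (pi c _ _ _ _ _ _) with () ← whnf-unique (red b) (red c) sort pi
Ty-trans h h' (pi _ b _ _ _ _ _) (sort _ c _) with () ← whnf-unique (red b) (red c) pi sort

-- Renaming, weak head expansion, neutral terms and change of bound

Ty-cast : ∀ {k s Γ A A' B B'} → A ≡ A' → B ≡ B' → TY k s Γ A B → TY k s Γ A' B'
Ty-cast refl refl 𝓐 = 𝓐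

Dom-cast : ∀ {k a s Γ A A' B B'} → A ≡ A' → B ≡ B' → DOM k a s Γ A B → DOM k a s Γ A' B'
Dom-cast refl refl 𝓐 = 𝓐

El-cast : ∀ {k s Γ A A' B B' t t' u u'} (p : A ≡ A') (q : B ≡ B') (𝓐 : TY k s Γ A B) →
          t ≡ t' → u ≡ u' → El 𝓐 t u → El (Ty-cast p q 𝓐) t' u'
El-cast refl refl 𝓐 refl refl e = e

ElD-uncast : ∀ {k a s Γ A A' B B' x y} (p : A ≡ A') (q : B ≡ B') (𝓐 : DOM k a s Γ A B) →
             ElD (Dom-cast p q 𝓐) x y → ElD 𝓐 x y
ElD-uncast refl refl 𝓐 e = e

rename-fuse : ∀ ρ' ρ t → rename (ρ' ∘ ρ) t ≡ rename ρ' (rename ρ t)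
rename-fuse ρ' ρ t = sym (rename-rename (λ _ → refl) t)

rename-ext-fuse : ∀ ρ' ρ t x → rename (ext (ρ' ∘ ρ)) t [ x ] ≡ rename (ext ρ') (rename (ext ρ) t) [ x ]
rename-ext-fuse ρ' ρ t x = cong (_[ x ]) (sym (rename-rename (λ { zero → refl ; (suc _) → refl }) t))

-- The fields range over all renamings already, so renaming is precomposition; the casts correct for
-- `rename` composing only up to propositional equality.
Ty-rename : ∀ {k s Δ ρ Γ A B} → Ren Δ ρ Γ → TY k s Γ A B → TY k s Δ (rename ρ A) (rename ρ B)
Ty-rename r (sort p a b)   = sort p (⇘-rename r a) (⇘-rename r b)
Ty-rename {ρ = ρ} r (ne n m a b e) =
  ne (Ne-rename ρ n) (Ne-rename ρ m) (⇘-rename r a) (⇘-rename r b) (≈-rename r e)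
Ty-rename {ρ = ρ} r (pi {F = F} {F'} {G} {G'} a b e f g 𝓕 𝓖) =
  pi (⇘-rename r a) (⇘-rename r b) (≈-rename r e) (≈-rename r f) (≈-rename (Ren-ext r (≈-reflˡ f)) g)
    (λ r' → Dom-cast (rename-fuse _ ρ F) (rename-fuse _ ρ F') (𝓕 (Ren-∘ r' r)))
    (λ {_} {ρ'} {x} {y} r' xy → Ty-cast (rename-ext-fuse ρ' ρ G x) (rename-ext-fuse ρ' ρ G' y)
      (𝓖 (Ren-∘ r' r) (ElD-uncast (rename-fuse _ ρ F) (rename-fuse _ ρ F') (𝓕 (Ren-∘ r' r)) xy)))

El-rename : ∀ {k s Δ ρ Γ A B t u} → Props k → (r : Ren Δ ρ Γ) (𝓐 : TY k s Γ A B) →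
            El 𝓐 t u → El (Ty-rename r 𝓐) (rename ρ t) (rename ρ u)
El-rename h r (sort p _ _)   (e , v) = ≈-rename r e , V-rename (h p) r v
El-rename h r (ne _ _ _ _ _) (e , _) = ≈-rename r e , tt
El-rename {ρ = ρ} {t = t} {u} h r (pi {a = a} {F = F} {F'} {G} {G'} _ _ _ _ _ 𝓕 𝓖) (e , f) =
  ≈-rename r e , λ {_} {ρ'} {x} {y} r' xy →
    let xy' = ElD-uncast (rename-fuse _ ρ F) (rename-fuse _ ρ F') (𝓕 (Ren-∘ r' r)) xy
    in El-cast (rename-ext-fuse ρ' ρ G x) (rename-ext-fuse ρ' ρ G' y) (𝓖 (Ren-∘ r' r) xy')
         (cong (λ v → app a v x) (rename-fuse ρ' ρ t)) (cong (λ v → app a v y) (rename-fuse ρ' ρ u))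
         (f (Ren-∘ r' r) xy')

Ty-expand : ∀ {k s Γ A A' B} → A ⇝* A' → Γ ⊢ A ≈ A' ∶ sort s → TY k s Γ A' B → TY k s Γ A B
Ty-expand rs e (sort p a b)           = sort p (⇘-expand rs e a) b
Ty-expand rs e (ne n m a b f)         = ne n m (⇘-expand rs e a) b f
Ty-expand rs e (pi a b e' f g 𝓕 𝓖) = pi (⇘-expand rs e a) b e' f g 𝓕 𝓖

-- The two fibres end in the same `Y`, and through it they give the equation between result types
-- that `≈-app` demands.
app-≈ : ∀ {k Γ a s s₁ s₂ A F G t t'} →
  Γ ⊢ A ≈ Pi a s₁ s₂ F G ∶ sort s → Γ ⊢ t ≈ t' ∶ A →
  ∀ {Δ ρ x x' Y} (r : Ren Δ ρ Γ) → Δ ⊢ x ≈ x' ∶⟨ a ⟩ rename ρ F →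
  TY k s₂ Δ (rename (ext ρ) G [ x ]) Y →
  TY k s₂ Δ (rename (ext ρ) G [ x' ]) Y →
  Δ ⊢ app a (rename ρ t) x ≈ app a (rename ρ t') x' ∶ rename (ext ρ) G [ x ]
app-≈ e f r x 𝓖 𝓖' =
  ≈-app (≈-rename r (≈-conv f e)) x (≈-trans (escape 𝓖) (≈-sym (escape 𝓖')))

-- Induction on the type: at `Pi` the reduction is carried into head position of the application by
-- `ξ`.
El-expandˡ : ∀ {k s Γ A B t t' u} → Props k → (𝓐 : TY k s Γ A B) →
             t ⇝* t' → Γ ⊢ t ≈ t' ∶ A → El 𝓐 t' u → El 𝓐 t u
El-expandˡ h (sort p (_ , e₀) _) rs e (e' , v) = ≈-trans e e' , V-expand (h p) rs (≈-conv e e₀) v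
El-expandˡ h (ne _ _ _ _ _) rs e (e' , _) = ≈-trans e e' , tt
El-expandˡ h (pi (_ , e₀) _ _ _ _ 𝓕 𝓖) rs e (e' , f) = ≈-trans e e' , λ {_} {ρ} r xy →
  El-expandˡ h (𝓖 r xy) (gmap (λ t → app _ t _) ξ (⇝*-rename ρ rs))
    (app-≈ e₀ e r (arg-reflˡ (ElD-arg (𝓕 r) xy)) (𝓖 r xy) (𝓖 r xy)) (f r xy)

El-expand : ∀ {k s Γ A B t t' u u'} → Props k → (𝓐 : TY k s Γ A B) →
            t ⇝* t' → Γ ⊢ t ≈ t' ∶ A → u ⇝* u' → Γ ⊢ u ≈ u' ∶ A → El 𝓐 t' u' → El 𝓐 t u
El-expand h 𝓐 rs e rs' e' x =
  El-expandˡ h 𝓐 rs e (El-sym h 𝓐 (El-expandˡ h 𝓐 rs' e' (El-sym h 𝓐 x)))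

-- A neutral term stays neutral when applied. This is what puts variables, hence the identity
-- substitution, into the relation.
El-ne : ∀ {k s Γ A B n m} → Props k → (𝓐 : TY k s Γ A B) → Ne n → Ne m → Γ ⊢ n ≈ m ∶ A → El 𝓐 n m
El-ne h (sort p (_ , e₀) _) n m e = e , V-ne (h p) n m (≈-conv e e₀)
El-ne h (ne _ _ _ _ _)      n m e = e , tt
El-ne h (pi (_ , e₀) _ _ _ _ 𝓕 𝓖) n m e = e , λ {_} {ρ} r xy →
  El-ne h (𝓖 r xy) (app (Ne-rename ρ n)) (app (Ne-rename ρ m))
    (app-≈ e₀ e r (ElD-arg (𝓕 r) xy) (𝓖 r xy) (𝓖 r (ElD-reflʳ h (𝓕 r) xy)))

-- Domain and codomain of a `Pi` are interpreted over different bounds and have to meet at their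
-- maximum. Arguments of `𝓖` go the opposite way, by independence of the derivation.
Ty-lift : ∀ {k k' s Γ A B} → Props k → Props k' → k ≤ k' → TY k s Γ A B → TY k' s Γ A B
Dom-lift : ∀ {k k' a s Γ A B} → Props k → Props k' → k ≤ k' → DOM k a s Γ A B → DOM k' a s Γ A B

Dom-lift h h' l (rel 𝓐) = rel (Ty-lift h h' l 𝓐)
Dom-lift h h' l (irr e) = irr e

Ty-lift h h' l (sort p a b)   = sort (≤⇒≤′ (≤-trans (≤′⇒≤ p) l)) a b
Ty-lift h h' l (ne n m a b e) = ne n m a b e
Ty-lift h h' l (pi a b e f g 𝓕 𝓖) = pi a b e f g (λ r → Dom-lift h h' l (𝓕 r)) λ r xy →
  Ty-lift h h' l (𝓖 r (ElD-irrelevant h' h (Dom-lift h h' l (𝓕 r)) (𝓕 r) left xy))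

props : ∀ k → Props k
props (suc k) (≤′-reflexive refl) = record
  { V-sym    = Ty-sym (props k)
  ; V-trans  = Ty-trans (props k) (props k)
  ; V-rename = Ty-rename
  ; V-expand = Ty-expand
  ; V-ne     = λ n m e → ne n m (⇘-refl (≈-reflˡ e)) (⇘-refl (≈-reflʳ e)) e
  }
props (suc k) (≤′-step p) = props k p

-- The relation with its bound and sort hidden

infix 4 _⊩_≈_∶_≈_
_⊩_≈_∶_≈_ : Ctx → Tm → Tm → Tm → Tm → Set
Γ ⊩ t ≈ u ∶ A ≈ B = ∃[ k ] ∃[ s ] Σ (TY k s Γ A B) λ 𝓐 → El 𝓐 t u

⊩-El : ∀ {k s Γ A B C D t u} (𝓑 : TY k s Γ C D) → Share A B C D → Γ ⊩ t ≈ u ∶ A ≈ B → El 𝓑 t u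
⊩-El 𝓑 sh (k , _ , 𝓐 , e) = El-irrelevant (props k) (props _) 𝓐 𝓑 sh e

⊩-≈ : ∀ {Γ A B t u} → Γ ⊩ t ≈ u ∶ A ≈ B → Γ ⊢ t ≈ u ∶ A
⊩-≈ (_ , _ , _ , e , _) = e

⊩-type : ∀ {Γ A B t u} → Γ ⊩ t ≈ u ∶ A ≈ B → ∃[ s ] Γ ⊢ A ≈ B ∶ sort s
⊩-type (_ , _ , 𝓐 , _) = _ , escape 𝓐

⊩-cast : ∀ {Γ A A' B B' t t' u u'} → t ≡ t' → u ≡ u' → A ≡ A' → B ≡ B' →
         Γ ⊩ t ≈ u ∶ A ≈ B → Γ ⊩ t' ≈ u' ∶ A' ≈ B'
⊩-cast refl refl refl refl e = e

⊩-sym : ∀ {Γ A B t u} → Γ ⊩ t ≈ u ∶ A ≈ B → Γ ⊩ u ≈ t ∶ B ≈ A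
⊩-sym (k , s , 𝓐 , e) =
  k , s , Ty-sym h 𝓐 , El-irrelevant h h 𝓐 (Ty-sym h 𝓐) outer (El-sym h 𝓐 e)
  where h = props k

⊩-reflˡ : ∀ {Γ A B t u} → Γ ⊩ t ≈ u ∶ A ≈ B → Γ ⊩ t ≈ t ∶ A ≈ A
⊩-reflˡ (k , s , 𝓐 , e) =
  k , s , Ty-trans h h 𝓐 (Ty-sym h 𝓐) ,
  El-irrelevant h h 𝓐 (Ty-trans h h 𝓐 (Ty-sym h 𝓐)) left (El-trans h 𝓐 e (El-sym h 𝓐 e))
  where h = props k

⊩-rename : ∀ {Δ ρ Γ A B t u} → Ren Δ ρ Γ → Γ ⊩ t ≈ u ∶ A ≈ B →
           Δ ⊩ rename ρ t ≈ rename ρ u ∶ rename ρ A ≈ rename ρ B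
⊩-rename r (k , s , 𝓐 , e) = k , s , Ty-rename r 𝓐 , El-rename (props k) r 𝓐 e

⊩-sort : ∀ {Γ A B i} → Γ ⊢ A ≈ B ∶ sort (𝕊 i) → TY i (𝕊 i) Γ A B → Γ ⊩ A ≈ B ∶ sort (𝕊 i) ≈ sort (𝕊 i)
-- `suc i` is the least bound that admits `𝕊 i`, and there the interpretation computes to
-- `TY i (𝕊 i)`.
⊩-sort {i = i} e 𝓐 = suc i , 𝕊 (suc i) , sort (≤′-reflexive refl) q q , e , 𝓐
  where q = ⇘-refl (≈-sort (≈-wf e))

⊩-Ty : ∀ {Γ A B i T} → Γ ⊩ A ≈ B ∶ sort (𝕊 i) ≈ T → TY i (𝕊 i) Γ A B
⊩-Ty (k , _ , sort p (done , _) _ , _ , v) = transport (λ V → V _ _ _) (𝓤-unfold k p) v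
⊩-Ty (_ , _ , ne () _ (done , _) _ _ , _)
⊩-Ty (_ , _ , pi (() ◅ _ , _) _ _ _ _ _ _ , _)

-- Fundamental theorem

⊩-trans : ∀ {Γ A B C t u v} → Γ ⊩ t ≈ u ∶ A ≈ C → Γ ⊩ u ≈ v ∶ A ≈ B → Γ ⊩ t ≈ v ∶ A ≈ B
⊩-trans e (k , s , 𝓐 , f) = k , s , 𝓐 , El-trans (props k) 𝓐 (⊩-El 𝓐 left e) f

⊩-expand : ∀ {Γ A B t t' u u'} → t ⇝* t' → Γ ⊢ t ≈ t' ∶ A → u ⇝* u' → Γ ⊢ u ≈ u' ∶ B →
           Γ ⊩ t' ≈ u' ∶ A ≈ B → Γ ⊩ t ≈ u ∶ A ≈ B
⊩-expand rs e rs' e' (k , s , 𝓐 , f) =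
  k , s , 𝓐 , El-expand (props k) 𝓐 rs e rs' (≈-conv e' (≈-sym (escape 𝓐))) f

Dom-rename : ∀ {k a s Δ ρ Γ A B} → Ren Δ ρ Γ → DOM k a s Γ A B → DOM k a s Δ (rename ρ A) (rename ρ B)
Dom-rename r (rel 𝓐) = rel (Ty-rename r 𝓐)
Dom-rename r (irr e) = irr (≈-rename r e)

infix 4 _⊩_≈_∶⟨_⟩_≈_
_⊩_≈_∶⟨_⟩_≈_ : Ctx → Tm → Tm → Ann → Tm → Tm → Set
Γ ⊩ t ≈ u ∶⟨ a ⟩ A ≈ B = ∃[ k ] ∃[ s ] Σ (DOM k a s Γ A B) λ 𝓓 → ElD 𝓓 t u

infix 4 _⊩ˢ_≈_∶_
-- `val` speaks of relevant variables only. On irrelevant ones the two substitutions may differ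
-- arbitrarily, constrained only by the resurrected typings inside `subˡ` and `subʳ`.
record _⊩ˢ_≈_∶_ (Δ : Ctx) (σ σ' : ℕ → Tm) (Γ : Ctx) : Set where
  field
    val  : ∀ {x A} → Γ ∋ x ∶ A → Δ ⊩ σ x ≈ σ' x ∶ subst σ A ≈ subst σ' A
    subˡ : Substitution.Sub Δ σ Γ
    subʳ : Substitution.Sub Δ σ' Γ
open _⊩ˢ_≈_∶_

⊩ˢ-sym : ∀ {Δ σ σ' Γ} → Δ ⊩ˢ σ ≈ σ' ∶ Γ → Δ ⊩ˢ σ' ≈ σ ∶ Γ
⊩ˢ-sym S = record { val = ⊩-sym ∘ val S ; subˡ = subʳ S ; subʳ = subˡ S }

⊩ˢ-reflˡ : ∀ {Δ σ σ' Γ} → Δ ⊩ˢ σ ≈ σ' ∶ Γ → Δ ⊩ˢ σ ≈ σ ∶ Γ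
⊩ˢ-reflˡ S = record { val = ⊩-reflˡ ∘ val S ; subˡ = subˡ S ; subʳ = subˡ S }

⊩ˢ-rename : ∀ {Θ Δ ρ σ σ' Γ} → Ren Θ ρ Δ → Δ ⊩ˢ σ ≈ σ' ∶ Γ → Θ ⊩ˢ rename ρ ∘ σ ≈ rename ρ ∘ σ' ∶ Γ
⊩ˢ-rename r S = record
  { val  = λ {_} {A} i → ⊩-cast refl refl (rename-subst (λ _ → refl) A) (rename-subst (λ _ → refl) A)
                           (⊩-rename r (val S i))
  ; subˡ = Sub-rename r (subˡ S)
  ; subʳ = Sub-rename r (subʳ S)
  }

arg-sym : ∀ {Γ t u a A} → Γ ⊢ t ≈ u ∶⟨ a ⟩ A → Γ ⊢ u ≈ t ∶⟨ a ⟩ A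
arg-sym (arg-rel e)    = arg-rel (≈-sym e)
arg-sym (arg-irr e e') = arg-irr e' e

⊩ˢ-∷ : ∀ {Δ τ τ' Γ a U} → Δ ⊩ˢ τ ∘ suc ≈ τ' ∘ suc ∶ Γ →
       Δ ⊩ τ zero ≈ τ' zero ∶⟨ a ⟩ subst (τ ∘ suc) U ≈ subst (τ' ∘ suc) U → Δ ⊩ˢ τ ≈ τ' ∶ Γ ▷ (a , U)
⊩ˢ-∷ {Δ} {τ} {τ'} {Γ} {a} {U} S (k , s , 𝓓 , e) = record
  { val  = go 𝓓 e
  ; subˡ = Sub-∷ (subˡ S) (ElD-arg 𝓓 e)
  ; subʳ = Sub-∷ (subʳ S) (arg-conv (arg-sym (ElD-arg 𝓓 e)) (escapeD 𝓓))
  }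
  where
  cast : ∀ {x} A → Δ ⊩ τ x ≈ τ' x ∶ subst (τ ∘ suc) A ≈ subst (τ' ∘ suc) A →
         Δ ⊩ τ x ≈ τ' x ∶ subst τ (weaken A) ≈ subst τ' (weaken A)
  cast A = ⊩-cast refl refl (sym (subst-rename (λ _ → refl) A)) (sym (subst-rename (λ _ → refl) A))
  go : (𝓓 : DOM k a s Δ (subst (τ ∘ suc) U) (subst (τ' ∘ suc) U)) → ElD 𝓓 (τ zero) (τ' zero) →
       ∀ {x A} → (Γ ▷ (a , U)) ∋ x ∶ A → Δ ⊩ τ x ≈ τ' x ∶ subst τ A ≈ subst τ' A
  go (rel 𝓐) e here              = cast U (k , s , 𝓐 , e)
  go _       _ (there {U = A} i) = cast A (val S i)

⊩-var : ∀ {k a s Γ A B} → Wf (Γ ▷ (a , A)) → DOM k a s Γ A B →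
        Γ ▷ (a , A) ⊩ var zero ≈ var zero ∶⟨ a ⟩ weaken A ≈ weaken B
⊩-var w (rel 𝓐) =
  _ , _ , rel (Ty-rename (Ren-suc w) 𝓐) , El-ne (props _) (Ty-rename (Ren-suc w) 𝓐) var var (≈-var w here)
⊩-var w (irr e) =
  -- An irrelevant domain is just an equation and mentions no universe, so the bound is arbitrary.
  0 , _ , irr (≈-rename (Ren-suc w) e) , ≈-var (Wf-⊕ w) here , ≈-var (Wf-⊕ w) here

⊩-arg-cast : ∀ {Γ t u a A A' B B'} → A ≡ A' → B ≡ B' → Γ ⊩ t ≈ u ∶⟨ a ⟩ A ≈ B → Γ ⊩ t ≈ u ∶⟨ a ⟩ A' ≈ B'
⊩-arg-cast refl refl e = e

⊩ˢ-exts : ∀ {k Δ σ σ' Γ a s} U → Δ ⊩ˢ σ ≈ σ' ∶ Γ → DOM k a s Δ (subst σ U) (subst σ' U) →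
          Δ ▷ (a , subst σ U) ⊩ˢ exts σ ≈ exts σ' ∶ Γ ▷ (a , U)
⊩ˢ-exts U S 𝓓 = ⊩ˢ-∷ (⊩ˢ-rename (Ren-suc w) S)
  (⊩-arg-cast (rename-subst (λ _ → refl) U) (rename-subst (λ _ → refl) U) (⊩-var w 𝓓))
  where w = wf-▷ (Substitution.wf (subˡ S)) (≈-reflˡ (escapeD 𝓓))

infix 4 _⊨_≈_∶_
-- Quantifying over two substitutions at once makes functionality of substitution part of validity.
record _⊨_≈_∶_ (Γ : Ctx) (t u T : Tm) : Set where
  field at : ∀ {Δ σ σ'} → Δ ⊩ˢ σ ≈ σ' ∶ Γ → Δ ⊩ subst σ t ≈ subst σ' u ∶ subst σ T ≈ subst σ' T
open _⊨_≈_∶_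

⊨-sym : ∀ {Γ t u T} → Γ ⊨ t ≈ u ∶ T → Γ ⊨ u ≈ t ∶ T
⊨-sym e .at S = ⊩-sym (at e (⊩ˢ-sym S))

⊨-trans : ∀ {Γ t u v T} → Γ ⊨ t ≈ u ∶ T → Γ ⊨ u ≈ v ∶ T → Γ ⊨ t ≈ v ∶ T
⊨-trans e f .at S = ⊩-trans (at e (⊩ˢ-reflˡ S)) (at f S)

⊨-reflˡ : ∀ {Γ t u T} → Γ ⊨ t ≈ u ∶ T → Γ ⊨ t ≈ t ∶ T
⊨-reflˡ e = ⊨-trans e (⊨-sym e)

⊨-reflʳ : ∀ {Γ t u T} → Γ ⊨ t ≈ u ∶ T → Γ ⊨ u ≈ u ∶ T
⊨-reflʳ e = ⊨-trans (⊨-sym e) e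

⊨-Dom : ∀ {Γ U U' i} a → Γ ⊨ U ≈ U' ∶ sort (𝕊 i) →
        ∀ {Δ σ σ'} → Δ ⊩ˢ σ ≈ σ' ∶ Γ → DOM i a (𝕊 i) Δ (subst σ U) (subst σ' U')
⊨-Dom rel e S = rel (⊩-Ty (at e S))
⊨-Dom irr e S = irr (⊩-≈ (at e S))

⊨-conv : ∀ {Γ t u T T' i} → Γ ⊨ t ≈ u ∶ T → Γ ⊨ T ≈ T' ∶ sort (𝕊 i) → Γ ⊨ t ≈ u ∶ T'
⊨-conv {i = i} e f .at S =
  -- The old pair of `T` with itself and the new pair of `T'` with itself need not meet; `𝓑`, from
  -- `T` to `T'`, shares its left end with the old and its right end with the new.
  i , 𝕊 i , 𝓒 , El-irrelevant (props i) (props i) 𝓑 𝓒 right (⊩-El 𝓑 left (at e S))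
  where
  𝓑 = ⊩-Ty (at f S)
  𝓒 = ⊩-Ty (at (⊨-reflʳ f) S)

ElD-⊩ : ∀ {k k' a s Γ A B C x y} (𝓓 : DOM k a s Γ A B) → DOM k' a s Γ A C → ElD 𝓓 x y → Γ ⊩ x ≈ y ∶⟨ a ⟩ A ≈ C
ElD-⊩ 𝓓 𝓓' xy = _ , _ , 𝓓' , ElD-irrelevant (props _) (props _) 𝓓 𝓓' left xy

module _ {Γ a U U' T T' i j} (⊨U : Γ ⊨ U ≈ U' ∶ sort (𝕊 i)) (⊨T : Γ ▷ (a , U) ⊨ T ≈ T' ∶ sort (𝕊 j))
         {Δ σ σ'} (S : Δ ⊩ˢ σ ≈ σ' ∶ Γ) where

  ⊨-pi-≈ : Δ ⊢ subst σ (Pi a (𝕊 i) (𝕊 j) U T) ≈ subst σ' (Pi a (𝕊 i) (𝕊 j) U' T') ∶ sort (𝕊 (i ⊔ j))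
  ⊨-pi-cod : Δ ▷ (a , subst σ U) ⊢ subst (exts σ) T ≈ subst (exts σ') T' ∶ sort (𝕊 j)

  ⊨-pi-cod = ⊩-≈ (at ⊨T (⊩ˢ-exts U S (⊨-Dom a (⊨-reflˡ ⊨U) S)))
  ⊨-pi-≈ = ≈-pi (⊩-≈ (at ⊨U S)) ⊨-pi-cod (≈-context (⊩-≈ (at ⊨U S)) (≈-reflʳ ⊨-pi-cod)) (rule i j)

  ⊨-pi-dom : ∀ {Θ ρ} → Ren Θ ρ Δ → DOM (i ⊔ j) a (𝕊 i) Θ (rename ρ (subst σ U)) (rename ρ (subst σ' U'))
  ⊨-pi-dom r = Dom-lift (props i) (props (i ⊔ j)) (m≤m⊔n i j) (Dom-rename r (⊨-Dom a ⊨U S))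

  -- The arguments are related over `U` and `U'`, but both substitutions must extend by the same
  -- `U`; the two pairs share their left end.
  ⊨-pi-arg : ∀ {Θ ρ x y} (r : Ren Θ ρ Δ) → ElD (⊨-pi-dom r) x y →
             Θ ⊩ˢ x ∷ (rename ρ ∘ σ) ≈ y ∷ (rename ρ ∘ σ') ∶ Γ ▷ (a , U)
  ⊨-pi-arg r xy = ⊩ˢ-∷ (⊩ˢ-rename r S)
    (⊩-arg-cast (rename-subst (λ _ → refl) U) (rename-subst (λ _ → refl) U)
      (ElD-⊩ (⊨-pi-dom r) (Dom-rename r (⊨-Dom a (⊨-reflˡ ⊨U) S)) xy))

  ⊨-pi-fibre : ∀ {Θ ρ x y} (r : Ren Θ ρ Δ) → ElD (⊨-pi-dom r) x y →
               TY (i ⊔ j) (𝕊 j) Θ (rename (ext ρ) (subst (exts σ) T) [ x ]) (rename (ext ρ) (subst (exts σ') T') [ y ])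
  ⊨-pi-fibre {_} {ρ} {x} {y} r xy =
    Ty-cast (sym (rename-exts-[] ρ σ T x)) (sym (rename-exts-[] ρ σ' T' y))
      (Ty-lift (props j) (props (i ⊔ j)) (m≤n⊔m i j) (⊩-Ty (at ⊨T (⊨-pi-arg r xy))))

  ⊨-pi-Ty : TY (i ⊔ j) (𝕊 (i ⊔ j)) Δ (subst σ (Pi a (𝕊 i) (𝕊 j) U T)) (subst σ' (Pi a (𝕊 i) (𝕊 j) U' T'))
  ⊨-pi-Ty = pi (⇘-refl (≈-reflˡ ⊨-pi-≈)) (⇘-refl (≈-reflʳ ⊨-pi-≈)) ⊨-pi-≈ (⊩-≈ (at ⊨U S)) ⊨-pi-cod
    ⊨-pi-dom ⊨-pi-fibre

⊨-pi : ∀ {Γ a U U' T T' i j} → Γ ⊨ U ≈ U' ∶ sort (𝕊 i) → Γ ▷ (a , U) ⊨ T ≈ T' ∶ sort (𝕊 j) →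
       Γ ⊨ Pi a (𝕊 i) (𝕊 j) U T ≈ Pi a (𝕊 i) (𝕊 j) U' T' ∶ sort (𝕊 (i ⊔ j))
⊨-pi ⊨U ⊨T .at S = ⊩-sort (⊨-pi-≈ ⊨U ⊨T S) (⊨-pi-Ty ⊨U ⊨T S)

β-≈ : ∀ {Δ τ Γ a U T t x s₁ s₂} → Substitution.Sub Δ τ Γ → Γ ⊢ U ≈ U ∶ sort s₁ → Γ ▷ (a , U) ⊢ T ≈ T ∶ sort s₂ →
      Γ ▷ (a , U) ⊢ t ≈ t ∶ T → Δ ⊢ x ≈ x ∶⟨ a ⟩ subst τ U →
      Δ ⊢ app a (subst τ (lam a U t)) x ≈ subst (x ∷ τ) t ∶ subst (x ∷ τ) T
β-≈ {τ = τ} {T = T} {t} {x} S e f g h = ≈-cast refl (exts-[] τ t x) (exts-[] τ T x)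
  (≈-β (Substitution.≈-subst S e) (Substitution.≈-subst (Substitution.Sub-lift S e) f) g' h (≈-[] g' h))
  where g' = Substitution.≈-subst (Substitution.Sub-lift S e) g

β-⇝ : ∀ {a U t x} τ → app a (subst τ (lam a U t)) x ⇝* subst (x ∷ τ) t
β-⇝ {a} {U} {t} {x} τ = transport (app a (subst τ (lam a U t)) x ⇝*_) (exts-[] τ t x) (β ◅ done)

-- Related bodies give related abstractions by expanding one β-step on each side. The syntactic
-- derivations serve to type the two redexes under the substitutions.
⊨-lam : ∀ {Γ a U U' T t t' i j} →
  Γ ⊢ U ≈ U' ∶ sort (𝕊 i) → Γ ▷ (a , U) ⊢ T ≈ T ∶ sort (𝕊 j) → Γ ▷ (a , U) ⊢ t ≈ t' ∶ T →
  Γ ▷ (a , U') ⊢ T ≈ T ∶ sort (𝕊 j) → Γ ▷ (a , U') ⊢ t' ≈ t' ∶ T →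
  Γ ⊨ U ≈ U' ∶ sort (𝕊 i) → Γ ▷ (a , U) ⊨ T ≈ T ∶ sort (𝕊 j) → Γ ▷ (a , U) ⊨ t ≈ t' ∶ T →
  Γ ⊨ lam a U t ≈ lam a U' t' ∶ Pi a (𝕊 i) (𝕊 j) U T
⊨-lam {Γ} {a} {U} {U'} {T} {t} {t'} {i} {j} e f g f' g' ⊨U ⊨T ⊨t .at {Δ} {σ} {σ'} S =
  i ⊔ j , 𝕊 (i ⊔ j) , ⊨-pi-Ty ⊨UU ⊨T S , lam-≈ , λ {_} {ρ} {x} {y} r xy →
    ⊩-El (⊨-pi-fibre ⊨UU ⊨T S r xy) left (⊩-cast
      (cong (λ v → app a v x) (sym (rename-subst (λ _ → refl) (lam a U t))))
      (cong (λ v → app a v y) (sym (rename-subst (λ _ → refl) (lam a U' t'))))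
      (sym (rename-exts-[] ρ σ T x)) (sym (rename-exts-[] ρ σ' T y))
      (beta r xy))
  where
  ⊨UU : Γ ⊨ U ≈ U ∶ sort (𝕊 i)
  ⊨UU = ⊨-reflˡ ⊨U
  S⁺ = ⊩ˢ-exts U S (⊨-Dom a ⊨UU S)
  U≈U' = ⊩-≈ (at ⊨U S)
  T≈T = ≈-reflˡ (⊩-≈ (at ⊨T S⁺))
  t≈t' = ⊩-≈ (at ⊨t S⁺)
  lam-≈ : Δ ⊢ subst σ (lam a U t) ≈ subst σ' (lam a U' t') ∶ subst σ (Pi a (𝕊 i) (𝕊 j) U T)
  lam-≈ = ≈-lam U≈U' T≈T t≈t' (≈-context U≈U' T≈T) (≈-context U≈U' (≈-reflʳ t≈t'))
  beta : ∀ {Θ ρ x y} (r : Ren Θ ρ Δ) → ElD (⊨-pi-dom ⊨UU ⊨T S r) x y →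
         Θ ⊩ app a (subst (rename ρ ∘ σ) (lam a U t)) x ≈ app a (subst (rename ρ ∘ σ') (lam a U' t')) y
           ∶ subst (x ∷ (rename ρ ∘ σ)) T ≈ subst (y ∷ (rename ρ ∘ σ')) T
  beta {Θ} {ρ} {x} {y} r xy = ⊩-expand
    (β-⇝ {U = U} {t} (rename ρ ∘ σ)) (β-≈ (subˡ Sρ) (≈-reflˡ e) f (≈-reflˡ g) (arg-reflˡ x≈y))
    (β-⇝ {U = U'} {t'} (rename ρ ∘ σ')) (β-≈ (subʳ Sρ) (≈-reflʳ e) f' g'
      -- The right redex binds at `U'`, while `y` is typed at the left end `U`.
      (arg-conv (arg-reflˡ (arg-sym x≈y)) (⊩-≈ (at ⊨U Sρ))))
    (at ⊨t (⊨-pi-arg ⊨UU ⊨T S r xy))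
    where
    Sρ = ⊩ˢ-rename r S
    x≈y : Θ ⊢ x ≈ y ∶⟨ a ⟩ subst (rename ρ ∘ σ) U
    x≈y = transport (λ A → Θ ⊢ x ≈ y ∶⟨ a ⟩ A) (rename-subst (λ _ → refl) U)
            (ElD-arg (⊨-pi-dom ⊨UU ⊨T S r) xy)

rename-id : ∀ t → rename (λ x → x) t ≡ t
rename-id t = trans (rename≡subst (λ _ → refl) t) (subst-id (λ _ → refl) t)

rename-ext-id-[] : ∀ T x → rename (ext (λ x → x)) T [ x ] ≡ T [ x ]
rename-ext-id-[] T x = subst-rename (λ { zero → refl ; (suc _) → refl }) T

-- Application at the identity renaming. The domain relation appears only on opening the
-- interpretation of the function type, so the argument has to be related over all of them.
⊩-app : ∀ {Γ a s₁ s₂ F F' G G' t u x y} → Γ ⊩ t ≈ u ∶ Pi a s₁ s₂ F G ≈ Pi a s₁ s₂ F' G' →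
        (∀ {k s} (𝓓 : DOM k a s Γ F F') → ElD 𝓓 x y) → Γ ⊩ app a t x ≈ app a u y ∶ G [ x ] ≈ G' [ y ]
⊩-app {F = F} {F'} {G} {G'} {t} {u} {x} {y} (k , s , pi (done , e) (done , _) _ _ _ 𝓕 𝓖 , _ , f) xy =
  ⊩-cast (cong (λ v → app _ v x) (rename-id t)) (cong (λ v → app _ v y) (rename-id u))
    (rename-ext-id-[] G x) (rename-ext-id-[] G' y) (_ , _ , 𝓖 r xy' , f r xy')
  where
  r   = Ren-id (≈-wf e)
  xy' = ElD-uncast (rename-id F) (rename-id F') (𝓕 r) (xy (Dom-cast (rename-id F) (rename-id F') (𝓕 r)))
⊩-app (_ , _ , sort _ (() ◅ _ , _) _ , _) _
⊩-app (_ , _ , ne () _ (done , _) _ _ , _) _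
⊩-app (_ , _ , ne _ _ (() ◅ _ , _) _ _ , _) _
⊩-app (_ , _ , pi (() ◅ _ , _) _ _ _ _ _ _ , _) _
⊩-app (_ , _ , pi _ (() ◅ _ , _) _ _ _ _ _ , _) _

-- Functions are compared through application, and an applied η-expansion reaches the applied
-- function in one β-step.
⊩-η : ∀ {Γ a s₁ s₂ F G B t u V} → Γ ⊩ t ≈ u ∶ Pi a s₁ s₂ F G ≈ B →
      Γ ⊢ u ≈ lam a V (app a (weaken u) (var zero)) ∶ Pi a s₁ s₂ F G →
      Γ ⊩ t ≈ lam a V (app a (weaken u) (var zero)) ∶ Pi a s₁ s₂ F G ≈ B
⊩-η {a = a} {u = u} {V} (k , s , 𝓐@(pi (done , e₀) _ _ _ _ 𝓕 𝓖) , e , f) η =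
  k , s , 𝓐 , ≈-trans e η , λ {_} {ρ} {x} {y} r xy →
    let yy = ElD-reflʳ (props k) (𝓕 r) xy
    in El-sym h (𝓖 r xy) (El-expandˡ h (𝓖 r xy) (η-red ρ y ◅ done)
         -- This equation arises at `G [ y ]` but is wanted at `G [ x ]`; both are equal to
         -- `G' [ y ]`.
         (≈-conv (app-≈ e₀ (≈-sym η) r (ElD-arg (𝓕 r) yy) (𝓖 r yy) (𝓖 r yy))
           (≈-trans (escape (𝓖 r yy)) (≈-sym (escape (𝓖 r xy)))))
         (El-sym h (𝓖 r xy) (f r xy)))
  where
  h = props k
  η-red : ∀ ρ y → app a (rename ρ (lam a V (app a (weaken u) (var zero)))) y ⇝ app a (rename ρ u) y
  η-red ρ y = transport (λ v → app a (lam a (rename ρ V) (app a (rename (ext ρ) (weaken u)) (var zero))) y ⇝ app a v y)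
    (trans (cong (_[ y ]) (rename-ext-weaken u)) (weaken-[] (rename ρ u) y)) β
⊩-η (_ , _ , sort _ (() ◅ _ , _) _ , _) _
⊩-η (_ , _ , ne () _ (done , _) _ _ , _) _
⊩-η (_ , _ , ne _ _ (() ◅ _ , _) _ _ , _) _
⊩-η (_ , _ , pi (() ◅ _ , _) _ _ _ _ _ _ , _) _

fundamental : ∀ {Γ t u T} → Γ ⊢ t ≈ u ∶ T → Γ ⊨ t ≈ u ∶ T
-- An irrelevant argument calls only for the substitution lemma in the resurrected context, plus a
-- conversion of the right-hand one to the left type.
fundamental-arg : ∀ {Γ t u a A} → Γ ⊢ t ≈ u ∶⟨ a ⟩ A → ∀ {Δ σ σ'} → Δ ⊩ˢ σ ≈ σ' ∶ Γ →
                  ∀ {k s} (𝓓 : DOM k a s Δ (subst σ A) (subst σ' A)) → ElD 𝓓 (subst σ t) (subst σ' u)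

fundamental-arg (arg-rel e)    S (rel 𝓐) = ⊩-El 𝓐 left (at (fundamental e) S)
fundamental-arg (arg-irr e e') S (irr f) =
  Substitution.≈-subst (Substitution.Sub-⊕ (subˡ S)) e ,
  ≈-conv (Substitution.≈-subst (Substitution.Sub-⊕ (subʳ S)) e') (≈-⊕ (≈-sym f))

fundamental (≈-sort {i = i} _) .at S = ⊩-sort {i = suc i} (≈-sort w) (sort (≤′-reflexive refl) q q)
  where
  w = Substitution.wf (subˡ S)
  q = ⇘-refl (≈-sort w)
fundamental (≈-var _ i) .at S = val S i
fundamental (≈-pi e f _ (rule i j)) = ⊨-pi (fundamental e) (fundamental f)
fundamental (≈-lam {s₁ = 𝕊 i} {𝕊 j} e f g f' g') =
  ⊨-lam e f g f' g' (fundamental e) (fundamental f) (fundamental g)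
fundamental (≈-app {u = u} {T = T} {s₂ = 𝕊 j} e f g) .at {σ = σ} {σ'} S =
  -- Application ends in `T [ u ]` on the left and `T [ u' ]` on the right, while the goal has
  -- `T [ u ]` twice. The premise on `T` supplies `𝓒` for the goal, with the same left end.
  j , 𝕊 j , 𝓒 , ⊩-El 𝓒 left (⊩-cast refl refl (sym (subst-[] σ T u)) refl
    (⊩-app (at (fundamental e) S) (fundamental-arg f S)))
  where 𝓒 = ⊩-Ty (at (⊨-reflˡ (fundamental g)) S)
fundamental (≈-β {a = a} {U} {t} {T} {u} {𝕊 i} e f g h k) .at {σ = σ} {σ'} S =
  ⊩-expand (transport (app a (subst σ (lam a U t)) (subst σ u) ⇝*_) (sym (subst-[] σ t u)) (β ◅ done))
    (Substitution.≈-subst (subˡ S) (≈-β e f g h k)) done (Substitution.≈-subst (subʳ S) k)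
    (⊩-cast (fuse σ t) (fuse σ' t) (fuse σ T) (fuse σ' T)
      (at (fundamental g) (⊩ˢ-∷ {τ = subst σ u ∷ σ} {τ' = subst σ' u ∷ σ'} S (_ , _ , 𝓓 , fundamental-arg h S 𝓓))))
  where
  𝓓 = ⊨-Dom a (fundamental e) S
  fuse : ∀ σ v → subst (subst σ u ∷ σ) v ≡ subst σ (v [ u ])
  fuse σ v = sym (subst-subst (λ { zero → refl ; (suc _) → refl }) v)
fundamental (≈-η {a = a} {U} {T} {t} e f) .at {σ = σ} {σ'} S =
  ⊩-cast refl (cong (λ v → lam a (subst σ' U) (app a v (var zero))) (sym (subst-exts-weaken t))) refl refl
    (⊩-η (at (fundamental e) S) (≈-conv (≈-cast refl q refl (Substitution.≈-subst (subʳ S) (≈-η e f)))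
      (≈-sym (proj₂ (⊩-type (at (fundamental e) S))))))
  where q = cong (λ v → lam a (subst σ' U) (app a v (var zero))) (subst-exts-weaken t)
fundamental (≈-sym e) = ⊨-sym (fundamental e)
fundamental (≈-trans e f) = ⊨-trans (fundamental e) (fundamental f)
fundamental (≈-conv {s = 𝕊 i} e f) = ⊨-conv (fundamental e) (fundamental f)

-- Consequences and translation

-- By recursion on the context: each entry is interpreted by the fundamental theorem at the identity
-- on the preceding ones, and its variable is neutral or, if irrelevant, just well typed.
⊩ˢ-id : ∀ {Γ} → Wf Γ → Γ ⊩ˢ var ≈ var ∶ Γ
⊩ˢ-id wf-ε = record { val = λ () ; subˡ = Sub-id wf-ε ; subʳ = Sub-id wf-ε }
⊩ˢ-id w@(wf-▷ {a = a} {T} {𝕊 i} w' e) = ⊩ˢ-∷ (⊩ˢ-rename (Ren-suc w) (⊩ˢ-id w'))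
  (⊩-arg-cast (rename≡subst (λ _ → refl) T) (rename≡subst (λ _ → refl) T)
    (⊩-var w (Dom-cast (subst-id (λ _ → refl) T) (subst-id (λ _ → refl) T) (⊨-Dom a (fundamental e) (⊩ˢ-id w')))))

≈-⊩ : ∀ {Γ t u T} → Γ ⊢ t ≈ u ∶ T → Γ ⊩ t ≈ u ∶ T ≈ T
≈-⊩ {t = t} {u} {T} e =
  ⊩-cast (subst-id (λ _ → refl) t) (subst-id (λ _ → refl) u) (subst-id (λ _ → refl) T) (subst-id (λ _ → refl) T)
    (at (fundamental e) (⊩ˢ-id (≈-wf e)))

≈-type : ∀ {Γ t u T} → Γ ⊢ t ≈ u ∶ T → ∃[ s ] Γ ⊢ T ≈ T ∶ sort s
≈-type e = ⊩-type (≈-⊩ e)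

≈-Pi-injective : ∀ {Γ a s₁ s₂ s₁' s₂' U U' T T' s} →
  Γ ⊢ Pi a s₁ s₂ U T ≈ Pi a s₁' s₂' U' T' ∶ sort s →
  s₁ ≡ s₁' × s₂ ≡ s₂' × Γ ⊢ U ≈ U' ∶ sort s₁ × Γ ▷ (a , U) ⊢ T ≈ T' ∶ sort s₂
≈-Pi-injective {s = 𝕊 i} e with ⊩-Ty (≈-⊩ e)
... | pi (done , _) (done , _) _ f g _ _ = refl , refl , f , g
... | pi (done , _) (() ◅ _ , _) _ _ _ _ _
... | pi (() ◅ _ , _) _ _ _ _ _ _
... | sort _ (() ◅ _ , _) _
... | ne () _ (done , _) _ _
... | ne _ _ (() ◅ _ , _) _ _

≈-Pi-components : ∀ {Γ a s₁ s₂ U T t u} → Γ ⊢ t ≈ u ∶ Pi a s₁ s₂ U T →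
  Γ ⊢ U ≈ U ∶ sort s₁ × Γ ▷ (a , U) ⊢ T ≈ T ∶ sort s₂
≈-Pi-components e = proj₂ (proj₂ (≈-Pi-injective (proj₂ (≈-type e))))

-- Two extensions of the identity, by `u` and by `u'`, are related substitutions even when `u` and
-- `u'` are irrelevant and unequal.
≈-[]-cong : ∀ {Γ a U T u u' s₁ s₂} → Γ ⊢ U ≈ U ∶ sort s₁ → Γ ▷ (a , U) ⊢ T ≈ T ∶ sort s₂ →
            Γ ⊢ u ≈ u' ∶⟨ a ⟩ U → Γ ⊢ T [ u ] ≈ T [ u' ] ∶ sort s₂
≈-[]-cong {Γ} {a} {U} {T} {u} {u'} {𝕊 i} e f g = ⊩-≈ (at (fundamental f) (⊩ˢ-∷ (⊩ˢ-id w) (_ , _ , 𝓓 , uu')))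
  where
  w = ≈-wf e
  𝓓 : DOM i a (𝕊 i) Γ (subst var U) (subst var U)
  𝓓 = ⊨-Dom a (fundamental e) (⊩ˢ-id w)
  uu' : ElD 𝓓 u u'
  uu' = ElD-subst-id (fundamental-arg g (⊩ˢ-id w) 𝓓)
    where
    ElD-subst-id : ElD 𝓓 (subst var u) (subst var u') → ElD 𝓓 u u'
    ElD-subst-id rewrite subst-id (λ _ → refl) u | subst-id (λ _ → refl) u' = λ x → x

η-≈ : ∀ {Γ a s₁ s₂ U T t} → Γ ⊢ t ≈ t ∶ Pi a s₁ s₂ U T →
      Γ ⊢ t ≈ lam a U (app a (weaken t) (var zero)) ∶ Pi a s₁ s₂ U T
η-≈ {Γ} {a} {U = U} {T} {t} e with ≈-Pi-components e
... | f , g = ≈-η e (≈-lam f g body g body)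
  where
  w : Wf (Γ ▷ (a , U))
  w = wf-▷ (≈-wf e) f
  q = ext-weaken-[var] T
  body : Γ ▷ (a , U) ⊢ app a (weaken t) (var zero) ≈ app a (weaken t) (var zero) ∶ T
  body = ≈-cast refl refl q
    (≈-app (≈-rename (Ren-suc w) e) (arg-var w) (≈-cast (sym q) (sym q) refl g))

-- From the original system to the single judgement and back

wf⇒Wf : ∀ {Γ} → ⊢ Γ → Wf Γ
-- Injectivity, validity and functionality rebuild the added premises. They are applied to
-- derivations already translated, so the recursion stays structural.
ty⇒≈  : ∀ {Γ t T} → Γ ⊢ t ∶ T → Γ ⊢ t ≈ t ∶ T
ty⇒≈-arg : ∀ {Γ t a T} → Γ ⊢ t ∶[ a ] T → Γ ⊢ t ≈ t ∶⟨ a ⟩ T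
eq⇒≈  : ∀ {Γ t u T} → Γ ⊢ t ≣ u ∶ T → Γ ⊢ t ≈ u ∶ T
eq⇒≈-arg : ∀ {Γ t u a T} → Γ ⊢ t ≣ u ∶[ a ] T → Γ ⊢ t ≈ u ∶⟨ a ⟩ T

wf⇒Wf wf-ε       = wf-ε
wf⇒Wf (wf-▷ w d) = wf-▷ (wf⇒Wf w) (ty⇒≈ d)

ty⇒≈-arg (ty-rel d) = arg-rel (ty⇒≈ d)
ty⇒≈-arg (ty-irr d) = arg-irr (ty⇒≈ d) (ty⇒≈ d)

eq⇒≈-arg (eq-rel d)    = arg-rel (eq⇒≈ d)
eq⇒≈-arg (eq-irr d d') = arg-irr (ty⇒≈ d) (ty⇒≈ d')

ty⇒≈ (ty-sort w (ax _)) = ≈-sort (wf⇒Wf w)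
ty⇒≈ (ty-pi d d' r)     = ≈-pi (ty⇒≈ d) (ty⇒≈ d') (ty⇒≈ d') r
ty⇒≈ (ty-var w i)       = ≈-var (wf⇒Wf w) i
ty⇒≈ (ty-lam d d') with ≈-Pi-injective (ty⇒≈ d')
... | _ , _ , e , f = ≈-lam e f (ty⇒≈ d) f (ty⇒≈ d)
ty⇒≈ (ty-app d d') =
  ≈-app (ty⇒≈ d) (ty⇒≈-arg d') (≈-[] (proj₂ (≈-Pi-components (ty⇒≈ d))) (ty⇒≈-arg d'))
ty⇒≈ (ty-conv d d') = ≈-conv (ty⇒≈ d) (eq⇒≈ d')

eq⇒≈ (eq-β d d') with ≈-wf (ty⇒≈ d)
... | wf-▷ _ e = ≈-β e (proj₂ (≈-type (ty⇒≈ d))) (ty⇒≈ d) (ty⇒≈-arg d') (≈-[] (ty⇒≈ d) (ty⇒≈-arg d'))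
eq⇒≈ (eq-η d)       = η-≈ (ty⇒≈ d)
eq⇒≈ (eq-refl d)    = ty⇒≈ d
eq⇒≈ (eq-sym d)     = ≈-sym (eq⇒≈ d)
eq⇒≈ (eq-trans d d') = ≈-trans (eq⇒≈ d) (eq⇒≈ d')
eq⇒≈ (eq-pi d d' r) = ≈-pi (eq⇒≈ d) (eq⇒≈ d') (≈-context (eq⇒≈ d) (≈-reflʳ (eq⇒≈ d'))) r
eq⇒≈ (eq-lam d d' d'') =
  ≈-lam (eq⇒≈ d) (ty⇒≈ d') (eq⇒≈ d'') (≈-context (eq⇒≈ d) (ty⇒≈ d')) (≈-context (eq⇒≈ d) (≈-reflʳ (eq⇒≈ d'')))
eq⇒≈ (eq-app d d') with ≈-Pi-components (eq⇒≈ d)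
... | e , f = ≈-app (eq⇒≈ d) (eq⇒≈-arg d') (≈-[]-cong e f (eq⇒≈-arg d'))
eq⇒≈ (eq-conv d d') = ≈-conv (eq⇒≈ d) (eq⇒≈ d')

Wf⇒wf : ∀ {Γ} → Wf Γ → ⊢ Γ
≈⇒eq  : ∀ {Γ t u T} → Γ ⊢ t ≈ u ∶ T → Γ ⊢ t ≣ u ∶ T
≈⇒tyˡ : ∀ {Γ t u T} → Γ ⊢ t ≈ u ∶ T → Γ ⊢ t ∶ T
-- The right-hand typing of every rule is among its premises or follows from them by conversion, so
-- the way back is structural recursion on the derivation.
≈⇒tyʳ : ∀ {Γ t u T} → Γ ⊢ t ≈ u ∶ T → Γ ⊢ u ∶ T
≈⇒eq-arg  : ∀ {Γ t u a T} → Γ ⊢ t ≈ u ∶⟨ a ⟩ T → Γ ⊢ t ≣ u ∶[ a ] T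
≈⇒tyˡ-arg : ∀ {Γ t u a T} → Γ ⊢ t ≈ u ∶⟨ a ⟩ T → Γ ⊢ t ∶[ a ] T
≈⇒tyʳ-arg : ∀ {Γ t u a T} → Γ ⊢ t ≈ u ∶⟨ a ⟩ T → Γ ⊢ u ∶[ a ] T

Wf⇒wf wf-ε       = wf-ε
Wf⇒wf (wf-▷ w e) = wf-▷ (Wf⇒wf w) (≈⇒tyˡ e)

≈⇒eq-arg (arg-rel e)    = eq-rel (≈⇒eq e)
≈⇒eq-arg (arg-irr e e') = eq-irr (≈⇒tyˡ e) (≈⇒tyˡ e')

≈⇒tyˡ-arg (arg-rel e)   = ty-rel (≈⇒tyˡ e)
≈⇒tyˡ-arg (arg-irr e _) = ty-irr (≈⇒tyˡ e)

≈⇒tyʳ-arg (arg-rel e)    = ty-rel (≈⇒tyʳ e)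
≈⇒tyʳ-arg (arg-irr _ e') = ty-irr (≈⇒tyˡ e')

≈⇒eq (≈-sort w)        = eq-refl (ty-sort (Wf⇒wf w) (ax _))
≈⇒eq (≈-var w i)       = eq-refl (ty-var (Wf⇒wf w) i)
≈⇒eq (≈-pi e f _ r)    = eq-pi (≈⇒eq e) (≈⇒eq f) r
≈⇒eq (≈-lam e f g _ _) = eq-lam (≈⇒eq e) (≈⇒tyˡ f) (≈⇒eq g)
≈⇒eq (≈-app e f _)     = eq-app (≈⇒eq e) (≈⇒eq-arg f)
≈⇒eq (≈-β _ _ g h _)   = eq-β (≈⇒tyˡ g) (≈⇒tyˡ-arg h)
≈⇒eq (≈-η e _)         = eq-η (≈⇒tyˡ e)
≈⇒eq (≈-sym e)         = eq-sym (≈⇒eq e)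
≈⇒eq (≈-trans e f)     = eq-trans (≈⇒eq e) (≈⇒eq f)
≈⇒eq (≈-conv e f)      = eq-conv (≈⇒eq e) (≈⇒eq f)

≈⇒tyˡ (≈-sort w)     = ty-sort (Wf⇒wf w) (ax _)
≈⇒tyˡ (≈-var w i)    = ty-var (Wf⇒wf w) i
≈⇒tyˡ (≈-pi e f _ r) = ty-pi (≈⇒tyˡ e) (≈⇒tyˡ f) r
≈⇒tyˡ (≈-lam {s₁ = 𝕊 i} {𝕊 j} e f g _ _) = ty-lam (≈⇒tyˡ g) (ty-pi (≈⇒tyˡ e) (≈⇒tyˡ f) (rule i j))
≈⇒tyˡ (≈-app e f _)  = ty-app (≈⇒tyˡ e) (≈⇒tyˡ-arg f)
≈⇒tyˡ (≈-β {s₁ = 𝕊 i} {𝕊 j} e f g h _) =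
  ty-app (ty-lam (≈⇒tyˡ g) (ty-pi (≈⇒tyˡ e) (≈⇒tyˡ f) (rule i j))) (≈⇒tyˡ-arg h)
≈⇒tyˡ (≈-η e _)      = ≈⇒tyˡ e
≈⇒tyˡ (≈-sym e)      = ≈⇒tyʳ e
≈⇒tyˡ (≈-trans e _)  = ≈⇒tyˡ e
≈⇒tyˡ (≈-conv e f)   = ty-conv (≈⇒tyˡ e) (≈⇒eq f)

≈⇒tyʳ (≈-sort w)     = ty-sort (Wf⇒wf w) (ax _)
≈⇒tyʳ (≈-var w i)    = ty-var (Wf⇒wf w) i
≈⇒tyʳ (≈-pi e _ f r) = ty-pi (≈⇒tyʳ e) (≈⇒tyˡ f) r
≈⇒tyʳ (≈-lam {s₁ = 𝕊 i} {𝕊 j} e f _ f' g') =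
  ty-conv (ty-lam (≈⇒tyˡ g') (ty-pi (≈⇒tyʳ e) (≈⇒tyˡ f') (rule i j)))
    (eq-sym (eq-pi (≈⇒eq e) (≈⇒eq f) (rule i j)))
≈⇒tyʳ (≈-app e f g)   = ty-conv (ty-app (≈⇒tyʳ e) (≈⇒tyʳ-arg f)) (eq-sym (≈⇒eq g))
≈⇒tyʳ (≈-β _ _ _ _ e) = ≈⇒tyˡ e
≈⇒tyʳ (≈-η _ e)       = ≈⇒tyˡ e
≈⇒tyʳ (≈-sym e)       = ≈⇒tyˡ e
≈⇒tyʳ (≈-trans _ e)   = ≈⇒tyʳ e
≈⇒tyʳ (≈-conv e f)    = ty-conv (≈⇒tyʳ e) (≈⇒eq f)

theorem5p7 : ∀ {Γ a U U' T T' s₁ s₂ s₁' s₂' s₃} →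
    Γ ⊢ Pi a s₁ s₂ U T ≣ Pi a s₁' s₂' U' T' ∶ sort s₃ →
    (s₁ ≡ s₁') × (s₂ ≡ s₂') × (Γ ⊢ U ≣ U' ∶ sort s₁) × ((Γ ▷ (a , U)) ⊢ T ≣ T' ∶ sort s₂)
theorem5p7 d with ≈-Pi-injective (eq⇒≈ d)
... | p , q , e , f = p , q , ≈⇒eq e , ≈⇒eq f
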